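{- Let $h$ and $k$ be positive integers with $3 \leq h \leq k-1$, and let $A = \{a_1, \ldots, a_k\}$ be a set of positive integers with $a_1 < \cdots < a_k$. Then \[|h^{\wedge}_{\pm}A| \geq 2hk - h^2 + 1.\] This lower bound is best possible: for all such $h$ and $k$ there is a set $A$ of $k$ positive integers with $|h^{\wedge}_{\pm}A| = 2hk - h^2 + 1$.
   Context: For a finite set $A = \{a_1, \ldots, a_k\}$ of integers (with distinct $a_i$) and a positive integer $h$, the restricted $h$-fold signed sumset is \[h^{\wedge}_{\pm}A = \left\{ \sum_{i=1}^{k} \lambda_i a_i : \lambda_i \in \{ -1,0,1\} \text{ for } i=1,\ldots,k, \ \sum_{i=1}^{k} |\lambda_i| = h \right\}.\] -}

module Defs where

open import Data.Nat using (ℕ; zero; suc; _<_)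
open import Data.Integer using (ℤ; +_; _*_; _+_; -[1+_])
open import Data.Fin using (Fin)
open import Data.List using (List; length)
open import Data.List.Membership.Propositional using (_∈_)
open import Data.List.Relation.Unary.Unique.Propositional using (Unique)
open import Data.Product using (Σ; _×_; ∃)
open import Function.Bundles using (_⇔_)
open import Relation.Binary.PropositionalEquality using (_≡_)

data Sign : Set where
  neg zero pos : Sign

signℤ : Sign → ℤ
signℤ neg  = -[1+ 0 ]
signℤ zero = + 0
signℤ pos  = + 1

absSign : Sign → ℕ
absSign zero = 0
absSign neg  = 1
absSign pos  = 1

sumℕ : (k : ℕ) → (Fin k → ℕ) → ℕ
sumℕ zero    f = 0
sumℕ (suc k) f = f Fin.zero Data.Nat.+ sumℕ k (λ i → f (Fin.suc i))

sumℤ : (k : ℕ) → (Fin k → ℤ) → ℤ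
sumℤ zero    f = + 0
sumℤ (suc k) f = f Fin.zero + sumℤ k (λ i → f (Fin.suc i))

-- n ∈ h^∧_± A, where A = {a 0, …, a (k-1)} (a injective)
InSignedSumset : (k h : ℕ) → (Fin k → ℤ) → ℤ → Set
InSignedSumset k h a n =
  Σ (Fin k → Sign) λ lam →
    (sumℕ k (λ i → absSign (lam i)) ≡ h) ×
    (sumℤ k (λ i → signℤ (lam i) * a i) ≡ n)

HasCard : (ℤ → Set) → ℕ → Set
HasCard S m = Σ (List ℤ) λ L → Unique L × (∀ x → (x ∈ L) ⇔ S x) × (length L ≡ m)

StrictlyIncreasingPositive : (k : ℕ) → (Fin k → ℤ) → Set
StrictlyIncreasingPositive k a =
  (∀ i → + 0 Data.Integer.< a i) × (∀ i j → i Data.Fin.< j → a i Data.Integer.< a j)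

{-# OPTIONS --safe #-}
module Submission where

-- Lower bound.  Adding a new largest element a to the set adds h sums above all previous ones
-- (a plus h - 1 of the h largest old elements) and, by symmetry, h sums below, so the case k = h + 1
-- is decisive: n numbers have at least n² signed sums omitting exactly one of them.
-- When a largest element a is added to a set A of n numbers, a + (old sums) are new sums, and every
-- residue class modulo 2a that meets the new sums contains one outside a + (old sums), namely its
-- least one.  Hence it suffices to find 2n + 1 residue classes modulo 2a.  If some o ∈ A differs from a
-- in parity, take the sums of A with at most one minus sign, and those of A ∖ {o} increased by a.
-- If all numbers are even, halve them.  If all are odd, work modulo the odd number a, where the
-- ± b (b ∈ A) and 0 are distinct: the set V of full signed sums of A then has at least 2n + 1 residues.
-- Indeed, by induction this holds for the sets V(A ∖ {b}); if |V| ≤ 2n then for each b either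
-- 0 ∉ V(A ∖ {b}), which makes V invariant under 2b, or 0 ∈ V(A ∖ {b}), and then
-- V = {b + 2x : x ∈ {0} ∪ ±A, x ≠ b}.  Comparing these descriptions for all b forces 3b ≡ 0
-- for every b, but a cyclic group has only one pair ± b with this property.
-- The induction starts at n = 3, where 1, 3, 5 is the exceptional triple.
--
-- Sharpness.  For the odd numbers 1, 3, …, 2k - 1 the sums are all the integers of the right parity
-- between the extreme ones.

open import Defs
open import Data.Empty using (⊥; ⊥-elim)
open import Data.Fin as Fin using (Fin; toℕ)
open import Data.Integer hiding (suc; pos; neg)
open import Data.Integer.DivMod using (_%ℕ_; _/ℕ_; n%ℕd<d; a≡a%ℕn+[a/ℕn]*n)
open import Data.Integer.Divisibility.Signed using (_∣_; divides; _∣?_; ∣⇒∣ᵤ; ∣m∣n⇒∣m+n; ∣m⇒∣-m)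
open import Data.Integer.Properties
open import Data.Integer.Tactic.RingSolver using (solve-∀; solve)
open import Data.List using (List; []; _∷_; _++_; map; length; tabulate; reverse; applyUpTo; applyDownFrom)
-- Unambiguous names for the list constructors, as the ring solver quotes its list of variables.
open import Data.List using () renaming ([] to ⟨⟩; _∷_ to _▸_)
open import Data.List.Membership.Propositional using (_∈_; find; lose)
open import Data.List.Membership.Propositional.Properties using (∈-map⁺; ∈-map⁻; ∈-++⁺ˡ; ∈-++⁺ʳ; ∈-++⁻; ∈-∃++; ∈-applyUpTo⁺; ∈-applyUpTo⁻)
open import Data.List.Properties using (length-map; length-++; length-removeAt′; unfold-reverse; reverse-applyUpTo; length-reverse; length-tabulate; length-applyUpTo)
open import Data.List.Relation.Binary.Permutation.Propositional using (_↭_; refl; prep; swap; trans; ↭-sym; ↭-trans; ↭-reflexive; ↭⇒↭ₛ)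
open import Data.List.Relation.Binary.Permutation.Propositional.Properties using (↭-length; shift; ∈-resp-↭; All-resp-↭; ↭-reverse)
import Data.List.Relation.Binary.Permutation.Setoid.Properties as Permₛ
open import Data.List.Relation.Binary.Pointwise using (Pointwise; []; _∷_; Pointwise-length)
open import Data.List.Relation.Unary.All as All using (All; []; _∷_)
import Data.List.Relation.Unary.All.Properties as All
open import Data.List.Relation.Unary.AllPairs as AllPairs using (AllPairs; []; _∷_)
import Data.List.Relation.Unary.AllPairs.Properties as AllPairs
open import Data.List.Relation.Unary.Any as Any using (Any; here; there)
open import Data.List.Relation.Unary.Linked using (Linked; [-]; _∷_)
open import Data.List.Relation.Unary.Linked.Properties using (Linked⇒AllPairs)
open import Data.Nat as ℕ using (ℕ; zero; suc; z≤n; s≤s)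
import Data.Nat.Divisibility as ℕ
import Data.Nat.Properties as ℕ
import Data.Nat.Tactic.RingSolver as ℕ-Solver
open import Data.Product using (Σ; ∃; _×_; _,_; proj₁; proj₂)
open import Data.Sum using (_⊎_; inj₁; inj₂; [_,_])
open import Data.Unit using (⊤)
open import Function using (_∘_; flip)
open import Function.Bundles using (mk⇔; Equivalence)
open import Level using (0ℓ)
open import Relation.Binary using (Rel; Symmetric; Tri; tri<; tri≈; tri>)
open import Relation.Binary.PropositionalEquality as ≡ using (_≡_; _≢_; refl; sym; cong; cong₂; subst; subst₂; setoid; module ≡-Reasoning)
open import Relation.Nullary using (¬_; Dec; yes; no)
open import Relation.Nullary.Decidable using (map′; _⊎-dec_)
open import Relation.Unary using (Pred; Decidable)

-- Signed sums over lists

data Sums : ℕ → List ℤ → ℤ → Set where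
  nil   : Sums 0 [] (+ 0)
  skip  : ∀ {h a as x} → Sums h as x → Sums h (a ∷ as) x
  plus  : ∀ {h a as x} → Sums h as x → Sums (suc h) (a ∷ as) (a + x)
  minus : ∀ {h a as x} → Sums h as x → Sums (suc h) (a ∷ as) (- a + x)

Full : List ℤ → ℤ → Set
Full as = Sums (length as) as

Sums-resp-≡ : ∀ {h as x y} → x ≡ y → Sums h as x → Sums h as y
Sums-resp-≡ {h} {as} = subst (Sums h as)

Sums-length : ∀ {h as x} → Sums h as x → h ℕ.≤ length as
Sums-length nil       = z≤n
Sums-length (skip s)  = ℕ.m≤n⇒m≤1+n (Sums-length s)
Sums-length (plus s)  = s≤s (Sums-length s)
Sums-length (minus s) = s≤s (Sums-length s)

+-exchange : ∀ a b x → a + (b + x) ≡ b + (a + x)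
+-exchange = solve-∀

Sums-resp-↭ : ∀ {h as bs x} → as ↭ bs → Sums h as x → Sums h bs x
Sums-resp-↭ refl         s                 = s
Sums-resp-↭ (prep _ p)   (skip s)          = skip (Sums-resp-↭ p s)
Sums-resp-↭ (prep _ p)   (plus s)          = plus (Sums-resp-↭ p s)
Sums-resp-↭ (prep _ p)   (minus s)         = minus (Sums-resp-↭ p s)
Sums-resp-↭ (swap a b p) (skip (skip s))   = skip (skip (Sums-resp-↭ p s))
Sums-resp-↭ (swap a b p) (skip (plus s))   = plus (skip (Sums-resp-↭ p s))
Sums-resp-↭ (swap a b p) (skip (minus s))  = minus (skip (Sums-resp-↭ p s))
Sums-resp-↭ (swap a b p) (plus (skip s))   = skip (plus (Sums-resp-↭ p s))
Sums-resp-↭ (swap a b p) (plus (plus s))   = Sums-resp-≡ (+-exchange b a _) (plus (plus (Sums-resp-↭ p s)))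
Sums-resp-↭ (swap a b p) (plus (minus s))  = Sums-resp-≡ (+-exchange (- b) a _) (minus (plus (Sums-resp-↭ p s)))
Sums-resp-↭ (swap a b p) (minus (skip s))  = skip (minus (Sums-resp-↭ p s))
Sums-resp-↭ (swap a b p) (minus (plus s))  = Sums-resp-≡ (+-exchange b (- a) _) (plus (minus (Sums-resp-↭ p s)))
Sums-resp-↭ (swap a b p) (minus (minus s)) = Sums-resp-≡ (+-exchange (- b) (- a) _) (minus (minus (Sums-resp-↭ p s)))
Sums-resp-↭ (trans p q)  s                 = Sums-resp-↭ q (Sums-resp-↭ p s)

Full-resp-↭ : ∀ {as bs x} → as ↭ bs → Full as x → Full bs x
Full-resp-↭ p s = subst (λ n → Sums n _ _) (↭-length p) (Sums-resp-↭ p s)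

Sums-neg : ∀ {h as x} → Sums h as x → Sums h as (- x)
Sums-neg nil                = nil
Sums-neg (skip s)           = skip (Sums-neg s)
Sums-neg (plus {a = a} s)   = Sums-resp-≡ (sym (neg-distrib-+ a _)) (minus (Sums-neg s))
Sums-neg (minus {a = a} s)  = Sums-resp-≡ (solve-neg a _) (plus (Sums-neg s))
  where
  solve-neg : ∀ a x → a + - x ≡ - (- a + x)
  solve-neg = solve-∀

Sums-double : ∀ {h as x} → Sums h as x → Sums h (map (λ a → a + a) as) (x + x)
Sums-double nil = nil
Sums-double (skip s) = skip (Sums-double s)
Sums-double (plus {a = a} s) = Sums-resp-≡ (eq a _) (plus (Sums-double s))
  where
  eq : ∀ a x → (a + a) + (x + x) ≡ (a + x) + (a + x)
  eq = solve-∀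
Sums-double (minus {a = a} s) = Sums-resp-≡ (eq a _) (minus (Sums-double s))
  where
  eq : ∀ a x → - (a + a) + (x + x) ≡ (- a + x) + (- a + x)
  eq = solve-∀

-- The length bound rules out `skip`, so `b` carries a sign, and reversing it moves the sum by `2b`.
-- The direction depends on that sign, hence the disjunction.
Full-flip : ∀ {h as x b} → length as ℕ.≤ h → Sums h as x → b ∈ as →
            Sums h as (x + (b + b)) ⊎ Sums h as (x - (b + b))
Full-flip le (skip s) _ = ⊥-elim (ℕ.<⇒≱ (s≤s (Sums-length s)) le)
Full-flip le (plus {x = x} s) (here {a} refl) = inj₂ (Sums-resp-≡ (eq a x) (minus s))
  where
  eq : ∀ a x → - a + x ≡ a + x - (a + a)
  eq = solve-∀
Full-flip le (minus {x = x} s) (here {a} refl) = inj₁ (Sums-resp-≡ (eq a x) (plus s))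
  where
  eq : ∀ a x → a + x ≡ - a + x + (a + a)
  eq = solve-∀
Full-flip (s≤s le) (plus {a = a} s) (there i) with Full-flip le s i
... | inj₁ t = inj₁ (Sums-resp-≡ (sym (+-assoc a _ _)) (plus t))
... | inj₂ t = inj₂ (Sums-resp-≡ (sym (+-assoc a _ _)) (plus t))
Full-flip (s≤s le) (minus {a = a} s) (there i) with Full-flip le s i
... | inj₁ t = inj₁ (Sums-resp-≡ (sym (+-assoc (- a) _ _)) (minus t))
... | inj₂ t = inj₂ (Sums-resp-≡ (sym (+-assoc (- a) _ _)) (minus t))

sums : ℕ → List ℤ → List ℤ
sums zero    []       = + 0 ∷ []
sums (suc h) []       = []
sums zero    (a ∷ as) = sums zero as
sums (suc h) (a ∷ as) = sums (suc h) as ++ map (_+_ a) (sums h as) ++ map (_+_ (- a)) (sums h as)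

∈-sums⁺ : ∀ {h as x} → Sums h as x → x ∈ sums h as
∈-sums⁺ nil                        = here refl
∈-sums⁺ {zero}  (skip s)           = ∈-sums⁺ s
∈-sums⁺ {suc h} (skip s)           = ∈-++⁺ˡ (∈-sums⁺ s)
∈-sums⁺ {suc h} {_ ∷ as} (plus s)  = ∈-++⁺ʳ (sums (suc h) as) (∈-++⁺ˡ (∈-map⁺ _ (∈-sums⁺ s)))
∈-sums⁺ {suc h} {a ∷ as} (minus s) =
  ∈-++⁺ʳ (sums (suc h) as) (∈-++⁺ʳ (map (_+_ a) (sums h as)) (∈-map⁺ _ (∈-sums⁺ s)))

∈-sums⁻ : ∀ {x} h as → x ∈ sums h as → Sums h as x
∈-sums⁻ zero    []       (here refl) = nil
∈-sums⁻ zero    (a ∷ as) i           = skip (∈-sums⁻ zero as i)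
∈-sums⁻ (suc h) (a ∷ as) i with ∈-++⁻ (sums (suc h) as) i
... | inj₁ j = skip (∈-sums⁻ (suc h) as j)
... | inj₂ j with ∈-++⁻ (map (_+_ a) (sums h as)) j
...   | inj₁ l with _ , l′ , refl ← ∈-map⁻ _ l = plus (∈-sums⁻ h as l′)
...   | inj₂ l with _ , l′ , refl ← ∈-map⁻ _ l = minus (∈-sums⁻ h as l′)

anySum? : ∀ {P : ℤ → Set} → Decidable P → ∀ h as → Dec (∃ λ x → Sums h as x × P x)
anySum? P? h as = map′
  (λ i → let x , x∈ , px = find i in x , ∈-sums⁻ h as x∈ , px)
  (λ (x , s , px) → lose (∈-sums⁺ s) px)
  (Any.any? P? (sums h as))

-- A lower bound for a count up to a relation: `_≢_` counts elements, incongruence counts residue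
-- classes, and `_#_` below counts residue classes up to sign.
Many : Rel ℤ 0ℓ → Pred ℤ 0ℓ → ℕ → Set
Many R P n = ∃ λ L → AllPairs R L × All P L × n ℕ.≤ length L

module _ {P : Pred ℤ 0ℓ} {R : Rel ℤ 0ℓ} where

  Many-mono : ∀ {n m} → n ℕ.≤ m → Many R P m → Many R P n
  Many-mono le (L , r , p , le′) = L , r , p , ℕ.≤-trans le le′

  Many-⊆ : ∀ {Q n} → (∀ {x} → P x → Q x) → Many R P n → Many R Q n
  Many-⊆ f (L , r , p , le) = L , r , All.map f p , le

  Many-map : ∀ {R′ Q n} (f : ℤ → ℤ) → (∀ {x y} → R x y → R′ (f x) (f y)) →
             (∀ {x} → P x → Q (f x)) → Many R P n → Many R′ Q n
  Many-map f fr fp (L , r , p , le) =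
    map f L , AllPairs.map⁺ (AllPairs.map fr r) , All.map⁺ (All.map fp p) ,
    ℕ.≤-trans le (ℕ.≤-reflexive (sym (length-map f L)))

Many-∪ : ∀ {R P Q S n m} → (∀ {x y} → P x → Q y → R x y) →
         (∀ {x} → P x → S x) → (∀ {x} → Q x → S x) →
         Many R P n → Many R Q m → Many R S (n ℕ.+ m)
Many-∪ cross f g (L , r , p , le) (L′ , r′ , p′ , le′) =
  L ++ L′ , AllPairs.++⁺ r r′ (All.map (λ px → All.map (cross px) p′) p) ,
  All.++⁺ (All.map f p) (All.map g p′) ,
  ℕ.≤-trans (ℕ.+-mono-≤ le le′) (ℕ.≤-reflexive (sym (length-++ L)))

-- Once the partner of the first entry is deleted from `ys`, the other entries still have theirs,
-- since `clash` forbids sharing a partner.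
pigeonhole : ∀ {_#_ _~_ : Rel ℤ 0ℓ} → (∀ {x y z} → x # y → x ~ z → y ~ z → ⊥) →
             ∀ {xs ys} → AllPairs _#_ xs → All (λ x → Any (x ~_) ys) xs → length xs ℕ.≤ length ys
pigeonhole clash [] [] = z≤n
pigeonhole {_#_} {_~_} clash {x ∷ xs} {ys} (x# ∷ #xs) (i ∷ is) = begin
  suc (length xs)                   ≤⟨ s≤s (pigeonhole clash #xs (All.zipWith (λ (x#y , j) → avoid x#y i j) (x# , is))) ⟩
  suc (length (ys Any.─ i))         ≡⟨ length-removeAt′ ys (Any.index i) ⟨
  length ys                         ∎
  where
  open ℕ.≤-Reasoning
  avoid : ∀ {x y zs} → x # y → (i : Any (x ~_) zs) → Any (y ~_) zs → Any (y ~_) (zs Any.─ i)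
  avoid x#y (here p)  (here q)  = ⊥-elim (clash x#y p q)
  avoid x#y (here p)  (there j) = j
  avoid x#y (there i) (here q)  = here q
  avoid x#y (there i) (there j) = there (avoid x#y i j)

extract : ∀ {a : ℤ} {as} → a ∈ as → ∃ λ r → as ↭ a ∷ r
extract a∈ with us , vs , refl ← ∈-∃++ a∈ = us ++ vs , shift _ us vs

AllPairs-resp-↭ : ∀ {R : Rel ℤ 0ℓ} {as bs} → Symmetric R → as ↭ bs → AllPairs R as → AllPairs R bs
AllPairs-resp-↭ {R} R-sym p =
  Permₛ.AllPairs-resp-↭ (setoid ℤ) R-sym (≡.resp₂ R) (↭⇒↭ₛ p)

Full-sum : ∀ as → ∃ (Full as)
Full-sum []       = + 0 , nil
Full-sum (a ∷ as) = _ , plus (proj₂ (Full-sum as))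

-- Full signed sums modulo an odd number

module Residues (D : ℤ → Set) (D? : Decidable D) (D-0 : D (+ 0))
  (D-+ : ∀ {x y} → D x → D y → D (x + y)) (D-neg : ∀ {x} → D x → D (- x))
  (D-half : ∀ {x} → D (x + x) → D x) where

  infix 4 _≉_ _#_ _⋕_

  conv : ∀ {x} → D x → ∀ y → x ≡ y → D y
  conv d _ eq = subst D eq d

  -- `D` stands for divisibility by an odd modulus; oddness enters through `D-half`. The last
  -- condition of `_⋕_` excludes the 3-torsion to which the induction step would otherwise lead.
  _≉_ _#_ _⋕_ : Rel ℤ 0ℓ
  x ≉ y = ¬ D (x - y)
  x # y = ¬ D (x - y) × ¬ D (x + y)
  x ⋕ y = x # y × ¬ (D (x + x + x) × D (y + y + y))

  ¬D-neg : ∀ {x} → ¬ D x → ¬ D (- x)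
  ¬D-neg {x} n d = n (conv (D-neg d) x (neg-involutive x))

  0≉ : ∀ {x} → ¬ D x → + 0 ≉ x
  0≉ {x} n d = ¬D-neg n (conv d (- x) (+-identityˡ (- x)))

  #-sym : Symmetric _#_
  #-sym {x} {y} (p , q) =
    (λ d → p (conv (D-neg d) (x - y) (solve (x ▸ y ▸ ⟨⟩)))) , (λ d → q (conv d (x + y) (solve (x ▸ y ▸ ⟨⟩))))

  ⋕-sym : Symmetric _⋕_
  ⋕-sym {x} {y} (p , q) = #-sym {x} {y} p , λ (d , e) → q (e , d)

  signed : List ℤ → List ℤ
  signed as = as ++ map -_ as

  signed-length : ∀ as → length (signed as) ≡ length as ℕ.+ length as
  signed-length as = ≡.trans (length-++ as) (cong (length as ℕ.+_) (length-map -_ as))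

  -- Turns n nonzero classes up to sign into `2n` residues; `D-half` separates `x` from `- x`.
  signed-≉ : ∀ {as} → All (¬_ ∘ D) as → AllPairs _#_ as → AllPairs _≉_ (signed as)
  signed-≉ {as} as≉0 as# = AllPairs.++⁺
    (AllPairs.map proj₁ as#)
    (AllPairs.map⁺ (AllPairs.map (λ {x} {y} p (d : D (- x - - y)) → proj₁ p (conv (D-neg d) (x - y) (solve (x ▸ y ▸ ⟨⟩)))) as#))
    (All.map (λ {x} f → All.map⁺ (All.map (λ {y} g (d : D (x - - y)) → g (conv d (x + y) (solve (x ▸ y ▸ ⟨⟩)))) f)) (cross as≉0 as#))
    where
    cross : ∀ {as} → All (¬_ ∘ D) as → AllPairs _#_ as → All (λ x → All (λ y → ¬ D (x + y)) as) as
    cross [] [] = []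
    cross {x ∷ _} (p ∷ ps) (q ∷ qs) =
      ((p ∘ D-half) ∷ All.map proj₂ q) ∷
      All.zipWith (λ (r , s) → proj₂ (#-sym {x} r) ∷ s) (q , cross ps qs)

  -- The witnesses are the sums with at most one minus sign. Sums and differences of any two of them
  -- are doubles, such as `2c` and `2(a + b)`, so `D-half` reduces each case to a hypothesis.
  Full-many-±-3 : ∀ {a b c} → All (¬_ ∘ D) (a ∷ b ∷ c ∷ []) → AllPairs _#_ (a ∷ b ∷ c ∷ []) →
                  Many _#_ (Full (a ∷ b ∷ c ∷ [])) 4
  Full-many-±-3 {a} {b} {c} (a≉ ∷ b≉ ∷ c≉ ∷ []) (((a-b , a+b) ∷ (a-c , a+c) ∷ []) ∷ ((b-c , b+c) ∷ []) ∷ [] ∷ []) =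
    (a + (b + (c + + 0))) ∷ (a + (b + (- c + + 0))) ∷ (a + (- b + (c + + 0))) ∷ (- a + (b + (c + + 0))) ∷ [] ,
    ( ( ((λ d → c≉ (D-half (conv d (c + c) (solve (a ▸ b ▸ c ▸ ⟨⟩))))) , (λ d → a+b (D-half (conv d ((a + b) + (a + b)) (solve (a ▸ b ▸ c ▸ ⟨⟩))))))
      ∷ ((λ d → b≉ (D-half (conv d (b + b) (solve (a ▸ b ▸ c ▸ ⟨⟩))))) , (λ d → a+c (D-half (conv d ((a + c) + (a + c)) (solve (a ▸ b ▸ c ▸ ⟨⟩))))))
      ∷ ((λ d → a≉ (D-half (conv d (a + a) (solve (a ▸ b ▸ c ▸ ⟨⟩))))) , (λ d → b+c (D-half (conv d ((b + c) + (b + c)) (solve (a ▸ b ▸ c ▸ ⟨⟩))))))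
      ∷ [])
    ∷ ( ((λ d → b-c (D-half (conv d ((b - c) + (b - c)) (solve (a ▸ b ▸ c ▸ ⟨⟩))))) , (λ d → a≉ (D-half (conv d (a + a) (solve (a ▸ b ▸ c ▸ ⟨⟩))))))
      ∷ ((λ d → a-c (D-half (conv d ((a - c) + (a - c)) (solve (a ▸ b ▸ c ▸ ⟨⟩))))) , (λ d → b≉ (D-half (conv d (b + b) (solve (a ▸ b ▸ c ▸ ⟨⟩))))))
      ∷ [])
    ∷ ( ((λ d → a-b (D-half (conv d ((a - b) + (a - b)) (solve (a ▸ b ▸ c ▸ ⟨⟩))))) , (λ d → c≉ (D-half (conv d (c + c) (solve (a ▸ b ▸ c ▸ ⟨⟩))))))
      ∷ [])
    ∷ [] ∷ []) ,
    (plus (plus (plus nil)) ∷ plus (plus (minus nil)) ∷ plus (minus (plus nil)) ∷ minus (plus (plus nil)) ∷ []) ,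
    ℕ.≤-refl

  _~_ : Rel ℤ 0ℓ
  x ~ y = D (x - y) ⊎ D (x + y)

  representatives : ∀ L → ∃ λ L′ → AllPairs _#_ L′ × All (_∈ L) L′ × All (λ x → Any (x ~_) L′) L
  representatives [] = [] , [] , [] , []
  representatives (x ∷ L) with L′ , p , q , r ← representatives L
    with Any.any? (λ y → D? (x - y) ⊎-dec D? (x + y)) L′
  ... | yes i = L′ , p , All.map there q , i ∷ r
  ... | no ¬i = x ∷ L′ , All.map (λ n → n ∘ inj₁ , n ∘ inj₂) (All.¬Any⇒All¬ L′ ¬i) ∷ p ,
                here refl ∷ All.map there q , here (inj₁ (conv D-0 (x - x) (solve (x ▸ ⟨⟩)))) ∷ All.map there r

  FullMod : List ℤ → ℤ → Set
  FullMod as x = ∃ λ v → Full as v × D (v - x)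

  full-mod : ∀ {as x} → Full as x → FullMod as x
  full-mod {x = x} s = x , s , conv D-0 (x - x) (solve (x ▸ ⟨⟩))

  FullMod-resp : ∀ {as x y} → D (x - y) → FullMod as x → FullMod as y
  FullMod-resp {x = x} {y} e (v , s , d) = v , s , conv (D-+ d e) (v - y) (solve (v ▸ x ▸ y ▸ ⟨⟩))

  FullMod-neg : ∀ {as x} → FullMod as x → FullMod as (- x)
  FullMod-neg {x = x} (v , s , d) = - v , Sums-neg s , conv (D-neg d) (- v - - x) (solve (v ▸ x ▸ ⟨⟩))

  -- Take a maximal list of representatives up to sign. If it has at most `k` entries, each accounts
  -- for at most two residues.
  few-or-many : ∀ as k → Many _#_ (Full as) (suc k) ⊎
                (∀ {U} → AllPairs _≉_ U → All (FullMod as) U → length U ℕ.≤ k ℕ.+ k)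
  few-or-many as k with L , p , q , r ← representatives (sums (length as) as)
    with suc k ℕ.≤? length L
  ... | yes le = inj₁ (L , p , All.map (∈-sums⁻ (length as) as) q , le)
  ... | no ¬le = inj₂ λ {U} U≉ U⊆ → let
      L≤k = ℕ.≤-pred (ℕ.≰⇒> ¬le)
    in ℕ.≤-trans (pigeonhole {_~_ = λ x y → D (x - y)} (λ {x} {y} {z} → clash {x} {y} {z}) U≉ (All.map (λ {x} (v , s , d) → locate {v} {x} d (All.lookup r (∈-sums⁺ s))) U⊆))
       (ℕ.≤-trans (ℕ.≤-reflexive (signed-length L)) (ℕ.+-mono-≤ L≤k L≤k))
    where
    clash : ∀ {x y z} → x ≉ y → D (x - z) → D (y - z) → ⊥
    clash {x} {y} {z} x≉y d e = x≉y (conv (D-+ d (D-neg e)) (x - y) (solve (x ▸ y ▸ z ▸ ⟨⟩)))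
    locate : ∀ {v x L} → D (v - x) → Any (v ~_) L → Any (λ y → D (x - y)) (signed L)
    locate {v} {x} d i with find i
    ... | y , y∈ , inj₁ e = lose (∈-++⁺ˡ y∈) (conv (D-+ e (D-neg d)) (x - y) (solve (v ▸ x ▸ y ▸ ⟨⟩)))
    ... | y , y∈ , inj₂ e = lose (∈-++⁺ʳ _ (∈-map⁺ -_ y∈)) (conv (D-+ e (D-neg d)) (x - - y) (solve (v ▸ x ▸ y ▸ ⟨⟩)))

  shift-double-≉ : ∀ t {L} → AllPairs _≉_ L → AllPairs _≉_ (map (λ x → t + (x + x)) L)
  shift-double-≉ t = AllPairs.map⁺ ∘ AllPairs.map λ {x} {y} p (d : D (t + (x + x) - (t + (y + y)))) →
    p (D-half (conv d (x - y + (x - y)) (solve (t ▸ x ▸ y ▸ ⟨⟩))))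

  -- Structure of n numbers whose full sums have at most 2n residues

  module Few (as : List ℤ) (as≉0 : All (¬_ ∘ D) as) (as# : AllPairs _#_ as)
    (few : ∀ {U} → AllPairs _≉_ U → All (FullMod as) U → length U ℕ.≤ length as ℕ.+ length as)
    (rest-many : ∀ {a r} → as ↭ a ∷ r → Many _#_ (Full r) (length as)) where

    V : ℤ → Set
    V = FullMod as

    -- Otherwise `x` could be added to `U`, against `few`.
    cover : ∀ {U x} → AllPairs _≉_ U → All V U → length as ℕ.+ length as ℕ.≤ length U →
            V x → Any (λ y → D (x - y)) U
    cover {U} {x} U≉ U⊆ le Vx with Any.any? (λ y → D? (x - y)) U
    ... | yes i = i
    ... | no ¬i = ⊥-elim (ℕ.<⇒≱ (s≤s le) (few (All.¬Any⇒All¬ U ¬i ∷ U≉) (Vx ∷ U⊆)))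

    M : ℤ → Set
    M x = D x ⊎ ∃ λ c → c ∈ as × (D (x - c) ⊎ D (x + c))

    M-∈ : ∀ {c} → c ∈ as → M c
    M-∈ {c} c∈ = inj₂ (c , c∈ , inj₁ (conv D-0 (c - c) (solve (c ▸ ⟨⟩))))

    M-neg : ∀ {x} → M x → M (- x)
    M-neg (inj₁ d) = inj₁ (D-neg d)
    M-neg {x} (inj₂ (c , c∈ , inj₁ d)) = inj₂ (c , c∈ , inj₂ (conv (D-neg d) (- x + c) (solve (x ▸ c ▸ ⟨⟩))))
    M-neg {x} (inj₂ (c , c∈ , inj₂ d)) = inj₂ (c , c∈ , inj₁ (conv (D-neg d) (- x - c) (solve (x ▸ c ▸ ⟨⟩))))

    M-resp : ∀ {x y} → D (x - y) → M x → M y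
    M-resp {x} {y} e (inj₁ d) = inj₁ (conv (D-+ d (D-neg e)) y (solve (x ▸ y ▸ ⟨⟩)))
    M-resp {x} {y} e (inj₂ (c , c∈ , inj₁ d)) = inj₂ (c , c∈ , inj₁ (conv (D-+ d (D-neg e)) (y - c) (solve (x ▸ y ▸ c ▸ ⟨⟩))))
    M-resp {x} {y} e (inj₂ (c , c∈ , inj₂ d)) = inj₂ (c , c∈ , inj₂ (conv (D-+ d (D-neg e)) (y + c) (solve (x ▸ y ▸ c ▸ ⟨⟩))))

    -- The description `V = {a + 2x : x ∈ M, x ≢ a}` modulo `D`, where `M` is `{0} ∪ ± as`.
    record Exact (a : ℤ) : Set where
      field
        into : ∀ {x} → M x → ¬ D (x - a) → V (a + (x + x))
        from : ∀ {v} → V v → ∃ λ x → M x × ¬ D (x - a) × D (v - (a + (x + x)))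

    Periodic : ℤ → Set
    Periodic a = ∀ {v} → V v → V (v + (a + a)) × V (v - (a + a))

    plus-V : ∀ {a r u} → as ↭ a ∷ r → Full r u → V (a + u)
    plus-V p s = full-mod (Full-resp-↭ (↭-sym p) (plus s))

    minus-V : ∀ {a r u} → as ↭ a ∷ r → Full r u → V (- a + u)
    minus-V p s = full-mod (Full-resp-↭ (↭-sym p) (minus s))

    -- Since `z` vanishes, `a + z` realises `x = 0`, `- a + z` realises `x = - a`, and flipping `c`
    -- in `± z` realises `x = ± c`. These are `2n` residues, so by `cover` they are all of `V`.
    exact : ∀ {a r z} → as ↭ a ∷ r → Full r z → D z → Exact a
    exact {a} {r} {z} p s Dz = record { into = into ; from = from }
      where
      r≉0 : All (¬_ ∘ D) (a ∷ r)
      r≉0 = All-resp-↭ p as≉0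
      r# : AllPairs _#_ (a ∷ r)
      r# = AllPairs-resp-↭ (λ {x} {y} → #-sym {x} {y}) p as#
      -- A flip in `z` yields only one of `± 2c`; the negated sum yields the other, because `z`
      -- vanishes modulo `D`.
      flips : ∀ {c} → c ∈ r → V (a + (c + c)) × V (a - (c + c))
      flips {c} c∈ with Full-flip ℕ.≤-refl s c∈
      ... | inj₁ t = FullMod-resp (conv Dz (a + (z + (c + c)) - (a + (c + c))) (solve (a ▸ z ▸ c ▸ ⟨⟩))) (plus-V p t) ,
                     FullMod-resp (conv (D-neg Dz) (a + - (z + (c + c)) - (a - (c + c))) (solve (a ▸ z ▸ c ▸ ⟨⟩))) (plus-V p (Sums-neg t))
      ... | inj₂ t = FullMod-resp (conv (D-neg Dz) (a + - (z - (c + c)) - (a + (c + c))) (solve (a ▸ z ▸ c ▸ ⟨⟩))) (plus-V p (Sums-neg t)) ,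
                     FullMod-resp (conv Dz (a + (z - (c + c)) - (a - (c + c))) (solve (a ▸ z ▸ c ▸ ⟨⟩))) (plus-V p t)
      into : ∀ {x} → M x → ¬ D (x - a) → V (a + (x + x))
      into {x} (inj₁ d) n = FullMod-resp
        (conv (D-+ Dz (D-neg (D-+ d d))) (a + z - (a + (x + x))) (solve (a ▸ z ▸ x ▸ ⟨⟩))) (plus-V p s)
      into {x} (inj₂ (c , c∈ , d)) n with ∈-resp-↭ p c∈ | d
      ... | here refl | inj₁ e = ⊥-elim (n e)
      ... | here refl | inj₂ e = FullMod-resp
        (conv (D-+ Dz (D-neg (D-+ e e))) (- a + z - (a + (x + x))) (solve (a ▸ z ▸ x ▸ ⟨⟩))) (minus-V p s)
      ... | there c∈r | inj₁ e = FullMod-resp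
        (conv (D-neg (D-+ e e)) (a + (c + c) - (a + (x + x))) (solve (a ▸ c ▸ x ▸ ⟨⟩))) (proj₁ (flips c∈r))
      ... | there c∈r | inj₂ e = FullMod-resp
        (conv (D-neg (D-+ e e)) (a - (c + c) - (a + (x + x))) (solve (a ▸ c ▸ x ▸ ⟨⟩))) (proj₂ (flips c∈r))
      X : List ℤ
      -- All of `M` except `a`: `1 + (n - 1) + n = 2n` entries.
      X = + 0 ∷ r ++ map -_ (a ∷ r)
      X-length : length as ℕ.+ length as ≡ length X
      X-length = ≡.trans (cong (λ n → n ℕ.+ n) (↭-length p)) (cong suc
        (≡.trans (cong (length r ℕ.+_) (sym (length-map -_ (a ∷ r)))) (sym (length-++ r))))
      X≉ : AllPairs _≉_ (a ∷ X)
      X≉ with a≉ ∷ ≉ ← signed-≉ r≉0 r# =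
        ((λ d → All.head r≉0 (conv d a (solve (a ▸ ⟨⟩)))) ∷ a≉) ∷
        (All.map 0≉ nonzero) ∷ ≉
        where
        nonzero : All (¬_ ∘ D) (r ++ map -_ (a ∷ r))
        nonzero = All.++⁺ (All.tail r≉0)
          (All.map⁺ (All.map ¬D-neg r≉0))
      X⊆M : All M X
      X⊆M = inj₁ D-0 ∷ All.++⁺ (All.tail ms) (All.map⁺ (All.map M-neg ms))
        where
        ms : All M (a ∷ r)
        ms = All.tabulate (M-∈ ∘ ∈-resp-↭ (↭-sym p))
      X≉a : All (λ x → ¬ D (x - a)) X
      X≉a = All.map (λ {x} n (d : D (x - a)) → n (conv (D-neg d) (a - x) (solve (a ▸ x ▸ ⟨⟩)))) (AllPairs.head X≉)
      from : ∀ {v} → V v → ∃ λ x → M x × ¬ D (x - a) × D (v - (a + (x + x)))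
      from Vv with find (cover (shift-double-≉ a (AllPairs.tail X≉))
                         (All.map⁺ (All.zipWith (λ (m , n) → into m n) (X⊆M , X≉a)))
                         (ℕ.≤-reflexive (≡.trans X-length (sym (length-map _ X)))) Vv)
      ... | y , y∈ , d with x , x∈ , refl ← ∈-map⁻ _ y∈ = x , All.lookup X⊆M x∈ , All.lookup X≉a x∈ , d

    -- The n classes up to sign of full sums of `r` are nonzero and give `2n` residues `u`. The
    -- `a + u` then exhaust `V`, and replacing `a + u` by `- a + u` subtracts `2a`. The other
    -- direction follows from `V = - V`.
    periodic : ∀ {a r} → as ↭ a ∷ r → ¬ (∃ λ z → Full r z × D z) → Periodic a
    periodic {a} {r} p none {v} Vv with L , L# , L⊆r , L≥ ← rest-many p =
      FullMod-resp (conv D-0 (- (- v - (a + a)) - (v + (a + a))) (solve (v ▸ a ▸ ⟨⟩))) (FullMod-neg (down (FullMod-neg Vv))) ,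
      down Vv
      where
      L⊆ : All (Full r) (signed L)
      L⊆ = All.++⁺ L⊆r (All.map⁺ (All.map Sums-neg L⊆r))
      L≉ : AllPairs _≉_ (signed L)
      L≉ = signed-≉ (All.map (λ s d → none (_ , s , d)) L⊆r) L#
      le : length as ℕ.+ length as ℕ.≤ length (map (_+_ a) (signed L))
      le = ℕ.≤-trans (ℕ.+-mono-≤ L≥ L≥)
        (ℕ.≤-reflexive (sym (≡.trans (length-map (_+_ a) (signed L)) (signed-length L))))
      down : ∀ {v} → V v → V (v - (a + a))
      down {v} Vv with find (cover (AllPairs.map⁺ (AllPairs.map (λ {x} {y} n (d : D (a + x - (a + y))) →
                              n (conv d (x - y) (solve (a ▸ x ▸ y ▸ ⟨⟩)))) L≉)) (All.map⁺ (All.map (plus-V p) L⊆)) le Vv)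
      ... | y , y∈ , d with u , u∈ , refl ← ∈-map⁻ _ y∈ = FullMod-resp
        (conv (D-neg d) (- a + u - (v - (a + a))) (solve (a ▸ u ▸ v ▸ ⟨⟩))) (minus-V p (All.lookup L⊆ u∈))

    exact-or-periodic : ∀ {a} → a ∈ as → Exact a ⊎ Periodic a
    exact-or-periodic a∈ with r , p ← extract a∈ with anySum? D? (length r) r
    ... | yes (z , s , d) = inj₁ (exact p s d)
    ... | no none         = inj₂ (periodic p none)

    -- Otherwise `v` and all `v ± 2b` would be `2n + 1` residues in `V`.
    not-all-periodic : ¬ (∀ {a} → a ∈ as → Periodic a)
    not-all-periodic per with v , s ← Full-sum as =
      ℕ.<⇒≱ (ℕ.≤-reflexive (cong suc (sym (≡.trans (length-map _ (signed as)) (signed-length as)))))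
        (few {v ∷ map (λ x → v + (x + x)) (signed as)}
          (subst (λ w → AllPairs _≉_ (w ∷ map (λ x → v + (x + x)) (signed as))) (+-identityʳ v) (shift-double-≉ v {+ 0 ∷ signed as}
            (All.map 0≉
              (All.++⁺ as≉0 (All.map⁺ (All.map ¬D-neg as≉0)))
             ∷ signed-≉ as≉0 as#)))
          (full-mod s ∷ All.map⁺ (All.++⁺ (All.tabulate λ x∈ → proj₁ (per x∈ (full-mod s)))
            (All.map⁺ (All.tabulate λ {x} x∈ → subst V (cong (_+_ v) (neg-distrib-+ x x)) (proj₂ (per x∈ (full-mod s))))))))

    exact⇒V-a : ∀ {a} → a ∈ as → Exact a → V (- a)
    exact⇒V-a {a} a∈ e = subst V (eq a) (Exact.into e (M-neg (M-∈ a∈))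
      (λ d → All.lookup as≉0 a∈ (D-half (conv (D-neg d) (a + a) (solve (a ▸ ⟨⟩))))))
      where
      eq : ∀ a → a + (- a + - a) ≡ - a
      eq = solve-∀

    -- `3a = a + 2x` forces `x ≡ a`, the one value that `Exact` leaves out.
    exact⇒¬V3a : ∀ {a} → Exact a → ¬ V (a + (a + a))
    exact⇒¬V3a {a} e V3a with x , _ , n , d ← Exact.from e V3a =
      n (D-half (conv (D-neg d) (x - a + (x - a)) (solve (x ▸ a ▸ ⟨⟩))))

    -- Since `- a + 2b` lies in `V`, it is `a + 2x` with `x ≡ b - a` in `M`. Then `a - 2x ≡ 3a - 2b`
    -- lies in `V`, and adding the period `2b` gives the forbidden `3a`.
    exact⇒¬periodic : ∀ {a b} → a ∈ as → b ∈ as → Exact a → ¬ Periodic b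
    exact⇒¬periodic {a} {b} a∈ b∈ e per
      with x , Mx , _ , d ← Exact.from e (proj₁ (per (exact⇒V-a a∈ e))) =
      exact⇒¬V3a e (FullMod-resp
        (conv (D-+ d D-0) (a + (- x + - x) + (b + b) - (a + (a + a))) (solve (x ▸ a ▸ b ▸ ⟨⟩)))
        (proj₁ (per (Exact.into e (M-neg Mx) ¬D[-x-a]))))
      where
      ¬D[-x-a] : ¬ D (- x - a)
      ¬D[-x-a] d′ = All.lookup as≉0 b∈
        (D-half (conv (D-+ d (D-neg (D-+ d′ d′))) (b + b) (solve (x ▸ a ▸ b ▸ ⟨⟩))))

    module _ (ex : ∀ {a} → a ∈ as → Exact a) where

      -- `c + 2x` is in `V`, hence so is its negative, which is therefore `c + 2y` with `y` in `M`;
      -- so `y ≡ - (x + c)`.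
      M-+ : ∀ {x c} → c ∈ as → M x → ¬ D (x - c) → M (x + c)
      M-+ {x} {c} c∈ Mx n
        with y , My , _ , d ← Exact.from (ex c∈) (FullMod-neg (Exact.into (ex c∈) Mx n)) =
        M-resp (D-half (conv d (- y - (x + c) + (- y - (x + c))) (solve (x ▸ y ▸ c ▸ ⟨⟩)))) (M-neg My)

      M-- : ∀ {x c} → c ∈ as → M x → ¬ D (x + c) → M (x - c)
      M-- {x} {c} c∈ Mx n = subst M (eq x c)
        (M-neg (M-+ c∈ (M-neg Mx) (λ d → n (conv (D-neg d) (x + c) (solve (x ▸ c ▸ ⟨⟩))))))
        where
        eq : ∀ x c → - (- x + c) ≡ x - c
        eq = solve-∀

      -- 2a = (a + b) + (a - b), and both summands are ± elements of as.
      M-double : ∀ {a b} → a ∈ as → b ∈ as → a # b → M (a + a)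
      M-double {a} {b} a∈ b∈ a#b = double (M-+ b∈ (M-∈ a∈) (proj₁ a#b))
        where
        a-b : M (a - b)
        a-b = M-- b∈ (M-∈ a∈) (proj₂ a#b)
        b≉0 : ¬ D b
        b≉0 = All.lookup as≉0 b∈
        double : M (a + b) → M (a + a)
        double (inj₁ d) = ⊥-elim (proj₂ a#b d)
        double (inj₂ (c , c∈ , inj₁ d)) = M-resp
          (conv (D-neg d) (a - b + c - (a + a)) (solve (a ▸ b ▸ c ▸ ⟨⟩)))
          (M-+ c∈ a-b λ d′ → b≉0 (D-half (conv (D-+ d (D-neg d′)) (b + b) (solve (a ▸ b ▸ c ▸ ⟨⟩)))))
        double (inj₂ (c , c∈ , inj₂ d)) = M-resp
          (conv (D-neg d) (a - b - c - (a + a)) (solve (a ▸ b ▸ c ▸ ⟨⟩)))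
          (M-- c∈ a-b λ d′ → b≉0 (D-half (conv (D-+ d (D-neg d′)) (b + b) (solve (a ▸ b ▸ c ▸ ⟨⟩)))))

      -- If `3a` is nonzero, then `- 2a` is an element of `M` other than `a`, so
      -- `a + 2(- 2a) = - 3a` lies in `V`, and by symmetry so does the forbidden `3a`.
      three-torsion : ∀ {a b} → a ∈ as → b ∈ as → a # b → D (a + a + a)
      three-torsion {a} {b} a∈ b∈ a#b with D? (a + a + a)
      ... | yes d = d
      ... | no n  = ⊥-elim (exact⇒¬V3a (ex a∈) (subst V (eq a) (FullMod-neg
        (Exact.into (ex a∈) (M-neg (M-double a∈ b∈ a#b)) (λ d → n (conv (D-neg d) (a + a + a) (solve (a ▸ ⟨⟩))))))))
        where
        eq : ∀ a → - (a + (- (a + a) + - (a + a))) ≡ a + (a + a)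
        eq = solve-∀

    all-exact : ∀ {a} → a ∈ as → Exact a → ∀ {b} → b ∈ as → Exact b
    all-exact a∈ e b∈ with exact-or-periodic b∈
    ... | inj₁ e′  = e′
    ... | inj₂ per = ⊥-elim (exact⇒¬periodic a∈ b∈ e per)

    some-exact : ∃ λ a → a ∈ as × Exact a
    some-exact with search as (λ i → i)
      where
      search : ∀ bs → (∀ {b} → b ∈ bs → b ∈ as) →
               (∃ λ a → a ∈ as × Exact a) ⊎ (∀ {a} → a ∈ bs → Periodic a)
      search [] _ = inj₂ λ ()
      search (b ∷ bs) sub with exact-or-periodic (sub (here refl)) | search bs (sub ∘ there)
      ... | inj₁ e | _ = inj₁ (b , sub (here refl) , e)
      ... | inj₂ _ | inj₁ found = inj₁ found
      ... | inj₂ p | inj₂ ps = inj₂ λ { (here refl) → p ; (there i) → ps i }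
    ... | inj₁ found = found
    ... | inj₂ per   = ⊥-elim (not-all-periodic per)

    few⇒three-torsion : ∀ {a b} → a ∈ as → b ∈ as → a # b → D (a + a + a) × D (b + b + b)
    few⇒three-torsion {a} {b} a∈ b∈ a#b with c , c∈ , e ← some-exact =
      three-torsion (all-exact c∈ e) a∈ b∈ a#b , three-torsion (all-exact c∈ e) b∈ a∈ (#-sym {a} {b} a#b)

  -- Induction on the length n, giving n + 1 classes up to sign. If a step failed, `Few` would make
  -- the first two entries 3-torsion, which `_⋕_` forbids.
  Full-many-± : ∀ k as → length as ≡ 3 ℕ.+ k → All (¬_ ∘ D) as → AllPairs _⋕_ as →
                Many _#_ (Full as) (4 ℕ.+ k)
  Full-many-± zero (_ ∷ _ ∷ _ ∷ []) refl as≉0 as⋕ = Full-many-±-3 as≉0 (AllPairs.map proj₁ as⋕)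
  Full-many-± (suc k) (a ∷ b ∷ as) len as≉0 as⋕@((a⋕b ∷ _) ∷ _) with few-or-many (a ∷ b ∷ as) (4 ℕ.+ k)
  ... | inj₁ many = many
  ... | inj₂ few  = ⊥-elim (proj₂ a⋕b (Few.few⇒three-torsion (a ∷ b ∷ as) as≉0 (AllPairs.map proj₁ as⋕)
    (λ {U} → subst (λ n → AllPairs _≉_ U → All (FullMod (a ∷ b ∷ as)) U → length U ℕ.≤ n ℕ.+ n) (sym len) few)
    (λ {_} {r} p → subst (Many _#_ (Full r)) (sym len)
      (Full-many-± k r (ℕ.suc-injective (≡.trans (sym (↭-length p)) len))
        (All.tail (All-resp-↭ p as≉0)) (AllPairs.tail (AllPairs-resp-↭ (λ {x} {y} → ⋕-sym {x} {y}) p as⋕))))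
    (here refl) (there (here refl)) (proj₁ a⋕b)))

  -- At most one of the n + 1 classes up to sign is zero. Set aside that one, or any one if none is;
  -- the other n yield two residues each.
  Full-many : ∀ k as → length as ≡ 3 ℕ.+ k → All (¬_ ∘ D) as → AllPairs _⋕_ as →
              Many _≉_ (Full as) (suc (length as ℕ.+ length as))
  Full-many k as len as≉0 as⋕ with L , L# , L⊆ , L≥ ← Full-many-± k as len as≉0 as⋕ =
    unfold (isolate L L# (ℕ.≤-trans (s≤s z≤n) L≥))
    where
    isolate : ∀ L → AllPairs _#_ L → 1 ℕ.≤ length L → ∃ λ x → ∃ λ L′ → L ↭ x ∷ L′ × All (¬_ ∘ D) L′
    isolate L L# le with Any.any? D? L
    isolate L L# le | yes i with x , x∈ , Dx ← find i with L′ , p ← extract x∈ =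
      x , L′ , p , All.map (λ n Dy → proj₁ n (D-+ Dx (D-neg Dy)))
        (AllPairs.head (AllPairs-resp-↭ (λ {x} {y} → #-sym {x} {y}) p L#))
    isolate (x ∷ L′) L# le | no ¬i = x , L′ , refl , All.tail (All.¬Any⇒All¬ (x ∷ L′) ¬i)
    unfold : (∃ λ x → ∃ λ L′ → L ↭ x ∷ L′ × All (¬_ ∘ D) L′) →
             Many _≉_ (Full as) (suc (length as ℕ.+ length as))
    unfold (x , L′ , p , L′≉0) with x# ∷ L′# ← AllPairs-resp-↭ (λ {x} {y} → #-sym {x} {y}) p L#
                                  | xs ∷ L′⊆ ← All-resp-↭ p L⊆ =
      x ∷ signed L′ ,
      All.++⁺ (All.map proj₁ x#) (All.map⁺ (All.map (λ {y} n (d : D (x - - y)) →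
        proj₂ n (conv d (x + y) (solve (x ▸ y ▸ ⟨⟩)))) x#)) ∷ signed-≉ L′≉0 L′# ,
      xs ∷ All.++⁺ L′⊆ (All.map⁺ (All.map Sums-neg L′⊆)) ,
      s≤s (ℕ.≤-trans (ℕ.+-mono-≤ le le) (ℕ.≤-reflexive (sym (signed-length L′))))
      where
      le : length as ℕ.≤ length L′
      le = ℕ.≤-pred (ℕ.≤-trans (ℕ.≤-reflexive (cong suc len)) (ℕ.≤-trans L≥ (ℕ.≤-reflexive (↭-length p))))

-- Parity and congruences between small integers

Even Odd : ℤ → Set
Even x = ∃ λ c → x ≡ c + c
Odd x  = ∃ λ c → x ≡ + 1 + (c + c)

parity : ∀ x → Even x ⊎ Odd x
parity x with x %ℕ 2 | n%ℕd<d x 2 | a≡a%ℕn+[a/ℕn]*n x 2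
... | 0 | _ | eq = inj₁ (x /ℕ 2 , ≡.trans eq (twice (x /ℕ 2)))
  where
  twice : ∀ q → + 0 + q * + 2 ≡ q + q
  twice = solve-∀
... | 1 | _ | eq = inj₂ (x /ℕ 2 , ≡.trans eq (twice (x /ℕ 2)))
  where
  twice : ∀ q → + 1 + q * + 2 ≡ + 1 + (q + q)
  twice = solve-∀
... | suc (suc _) | s≤s (s≤s ()) | _

¬Even×Odd : ∀ {x} → Even x → Odd x → ⊥
¬Even×Odd {x} (c , p) (d , q) = impossible (c - d) (begin
  c - d + (c - d)          ≡⟨ solve (c ▸ d ▸ ⟨⟩) ⟩
  c + c - (d + d)          ≡⟨ cong (_- (d + d)) (≡.trans (sym p) q) ⟩
  + 1 + (d + d) - (d + d)  ≡⟨ solve (d ▸ ⟨⟩) ⟩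
  + 1                      ∎)
  where
  open ≡-Reasoning
  impossible : ∀ e → e + e ≢ + 1
  impossible (+ 0) ()
  impossible (+ suc zero) ()
  impossible (+ suc (suc _)) ()
  impossible -[1+ _ ] ()

halve-≡ : ∀ {x y} → x + x ≡ y + y → x ≡ y
halve-≡ {x} {y} eq = *-cancelˡ-≡ (+ 2) x y (≡.trans (twice x) (≡.trans eq (sym (twice y))))
  where
  twice : ∀ x → + 2 * x ≡ x + x
  twice = solve-∀

<⇒0<- : ∀ {x y} → x < y → + 0 < y - x
<⇒0<- {x} {y} lt = subst (_< y - x) (+-inverseʳ x) (+-monoˡ-< (- x) lt)

0<-⇒< : ∀ {x y} → + 0 < y - x → x < y
0<-⇒< {x} {y} lt = subst₂ _<_ (+-identityˡ x) (eq x y) (+-monoˡ-< x lt)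
  where
  eq : ∀ x y → y - x + x ≡ y
  eq = solve-∀

double-cancel-< : ∀ {x y} → x + x < y + y → x < y
double-cancel-< {x} {y} lt with <-cmp x y
... | tri< x<y _ _ = x<y
... | tri≈ _ refl _ = ⊥-elim (<-irrefl refl lt)
... | tri> _ _ y<x = ⊥-elim (<-asym lt (+-mono-< y<x y<x))

small-multiple : ∀ {a b c} → + 0 ≤ b → b < a → + 0 ≤ c → c < a → a ∣ (b - c) → b ≡ c
small-multiple {+ a} {+ b} {+ c} _ (+<+ b<a) _ (+<+ c<a) a∣ =
  i-j≡0⇒i≡j (+ b) (+ c) (∣i∣≡0⇒i≡0 (vanish (∣⇒∣ᵤ a∣)
    (ℕ.≤-<-trans (ℕ.≤-trans (ℕ.≤-reflexive (cong ∣_∣ (m-n≡m⊖n b c))) (∣m⊝n∣≤m⊔n b c)) (ℕ.⊔-lub b<a c<a))))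
  where
  vanish : ∀ {m n} → n ℕ.∣ m → m ℕ.< n → m ≡ 0
  vanish {zero}  _   _   = refl
  vanish {suc m} n∣m m<n = ⊥-elim (ℕ.>⇒∤ m<n n∣m)

[_]_≢ₘ_ : ℤ → Rel ℤ 0ℓ
[ a ] x ≢ₘ y = ¬ (a ∣ (x - y))

-- Serves to move each representative within its residue class.
Many-choose : ∀ {R R′ : Rel ℤ 0ℓ} {P Q : Pred ℤ 0ℓ} {n} (_∼_ : Rel ℤ 0ℓ) →
              (∀ {x} → P x → ∃ λ y → Q y × x ∼ y) →
              (∀ {x y x′ y′} → R x y → x ∼ x′ → y ∼ y′ → R′ x′ y′) →
              Many R P n → Many R′ Q n
Many-choose {R} {R′} {P} {Q} _∼_ choose transfer (L , r , p , le) with go p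
  where
  go : ∀ {L} → All P L → ∃ λ L′ → Pointwise _∼_ L L′ × All Q L′
  go []       = [] , [] , []
  go (p ∷ ps) with y , q , x∼y ← choose p | L′ , es , qs ← go ps = y ∷ L′ , x∼y ∷ es , q ∷ qs
... | L′ , es , q = L′ , pairs es r , q , ℕ.≤-trans le (ℕ.≤-reflexive (Pointwise-length es))
  where
  row : ∀ {x x′ L L′} → x ∼ x′ → Pointwise _∼_ L L′ → All (R x) L → All (R′ x′) L′
  row e []       []       = []
  row e (f ∷ fs) (r ∷ rs) = transfer r e f ∷ row e fs rs
  pairs : ∀ {L L′} → Pointwise _∼_ L L′ → AllPairs R L → AllPairs R′ L′
  pairs []       []       = []
  pairs (e ∷ es) (r ∷ rs) = row e es r ∷ pairs es rs

a+x-a : ∀ a x → x ≡ a + x - a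
a+x-a = solve-∀

+-cancelˡ : ∀ a {x y} → a + x ≡ a + y → x ≡ y
+-cancelˡ a {x} {y} eq = ≡.trans (a+x-a a x) (≡.trans (cong (_- a) eq) (sym (a+x-a a y)))

lower-bound : ∀ (L : List ℤ) → ∃ λ B → All (B ≤_) L
lower-bound []      = + 0 , []
lower-bound (x ∷ L) with B , p ← lower-bound L =
  x ⊓ B , i⊓j≤i x B ∷ All.map (≤-trans (i⊓j≤j x B)) p

-- Every residue class modulo 2a that meets the sums of a ∷ as contains one that is not in a + Sums h as.
Many-classes : ∀ {h as a n c} → + 0 < a → Many _≢_ (Sums h as) n →
               Many [ a + a ]_≢ₘ_ (Sums (suc h) (a ∷ as)) c →
               Many _≢_ (Sums (suc h) (a ∷ as)) (n ℕ.+ c)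
Many-classes {h} {as} {a} 0<a many classes =
  Many-∪ {R = _≢_} {P = λ x → Sums h as (x - a)} {Q = Minimal} (λ { s (_ , ¬s) refl → ¬s s })
    (λ {x} s → Sums-resp-≡ (restore x a) (plus s)) proj₁
    (Many-map (_+_ a) (λ x≢y eq → x≢y (+-cancelˡ a eq)) (λ {x} → Sums-resp-≡ (a+x-a a x)) many)
    (Many-choose {R = [ a + a ]_≢ₘ_} (λ x y → (a + a) ∣ (x - y)) minimal (λ {x} {y} → incongruent {x} {y}) classes)
  where
  Minimal : ℤ → Set
  Minimal x = Sums (suc h) (a ∷ as) x × ¬ Sums h as (x - a)
  restore : ∀ x a → a + (x - a) ≡ x
  restore = solve-∀
  incongruent : ∀ {x y x′ y′} → [ a + a ] x ≢ₘ y → (a + a) ∣ (x - x′) → (a + a) ∣ (y - y′) → x′ ≢ y′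
  incongruent {x} {y} {x′} {.x′} n d e refl =
    n (subst (_ ∣_) (eq x y x′) (∣m∣n⇒∣m+n d (∣m⇒∣-m e)))
    where
    eq : ∀ x y z → x - z + - (y - z) ≡ x - y
    eq = solve-∀
  B : ℤ
  B = proj₁ (lower-bound (sums h as))
  B≤ : ∀ {x} → Sums h as x → B ≤ x
  B≤ s = All.lookup (proj₂ (lower-bound (sums h as))) (∈-sums⁺ s)
  0<-a : ∀ x → x - a < x
  0<-a x = 0<-⇒< (subst (+ 0 <_) (eq x a) 0<a)
    where
    eq : ∀ x a → a ≡ x - (x - a)
    eq = solve-∀
  pred-step : ∀ B n → -[1+ 0 ] + (B + (+ 1 + n)) ≡ B + n
  pred-step = solve-∀
  shift-down : ∀ x a → - a + (x - a) ≡ x - a - a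
  shift-down = solve-∀
  -- If `x - a` is an old sum, then `- a + (x - a) = x - 2a` is a smaller sum in the class of `x`.
  -- The fuel `n` bounds `x - B`; once it is spent, `x - a` would be an old sum below `B`.
  descend : ∀ n {x} → x ≤ B + + n → Sums (suc h) (a ∷ as) x → ∃ λ y → Minimal y × (a + a) ∣ (x - y)
  descend n {x} le s with anySum? (_≟ (x - a)) h as
  ... | no none = x , (s , λ t → none (_ , t , refl)) , divides (+ 0) (+-inverseʳ x)
  descend zero {x} le s | yes (_ , t , refl) = ⊥-elim (<-irrefl refl
    (<-≤-trans (0<-a x) (≤-trans (≤-trans le (≤-reflexive (+-identityʳ B))) (B≤ t))))
  descend (suc n) {x} le s | yes (_ , t , refl)
    with y , m , divides q eq ← descend n (≤-trans (i<j⇒i≤pred[j] (<-≤-trans (0<-a _) (≤-trans (<⇒≤ (0<-a x)) le))) (≤-reflexive (pred-step B (+ n)))) (Sums-resp-≡ (shift-down x a) (minus t))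
    = y , m , divides (q + + 1) (step x y a q eq)
    where
    step : ∀ x y a q → x - a - a - y ≡ q * (a + a) → x - y ≡ (q + + 1) * (a + a)
    step x y a q eq = begin
      x - y                    ≡⟨ solve (x ▸ y ▸ a ▸ ⟨⟩) ⟩
      x - a - a - y + (a + a)  ≡⟨ cong (_+ (a + a)) eq ⟩
      q * (a + a) + (a + a)    ≡⟨ solve (q ▸ a ▸ ⟨⟩) ⟩
      (q + + 1) * (a + a)      ∎
      where open ≡-Reasoning
  minimal : ∀ {x} → Sums (suc h) (a ∷ as) x → ∃ λ y → Minimal y × (a + a) ∣ (x - y)
  minimal {x} = descend ∣ x - B ∣ (≤-trans (≤-reflexive (eq x B)) (+-monoʳ-≤ B (i≤+∣i∣ (x - B))))
    where
    eq : ∀ x B → x ≡ B + (x - B)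
    eq = solve-∀
    i≤+∣i∣ : ∀ i → i ≤ + ∣ i ∣
    i≤+∣i∣ (+ n)    = ≤-refl
    i≤+∣i∣ -[1+ n ] = -≤+

-- Residue classes modulo 2a of the sums omitting one element

total : List ℤ → ℤ
total []       = + 0
total (a ∷ as) = a + total as

Full-total : ∀ as → Full as (total as)
Full-total []       = nil
Full-total (a ∷ as) = plus (Full-total as)

Full-total-flip : ∀ {as b} → b ∈ as → Full as (total as - (b + b))
Full-total-flip {a ∷ as} (here refl) = Sums-resp-≡ (eq a (total as)) (minus (Full-total as))
  where
  eq : ∀ a t → - a + t ≡ a + t - (a + a)
  eq = solve-∀
Full-total-flip {a ∷ as} (there i) = Sums-resp-≡ (sym (+-assoc a _ _)) (plus (Full-total-flip i))

Below : ℤ → ℤ → Set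
Below a b = + 0 < b × b < a

-- The sums `T - 2b` with `b = 0` or `b ∈ r`: these `b` are distinct in `[0, a)`, so their doubles
-- are incongruent modulo `2a`. The parity is kept for `many-mixed-parity`.
many-flips : ∀ {a r} → + 0 < a → All (Below a) r → AllPairs _≢_ r →
             Many [ a + a ]_≢ₘ_ (λ x → Full r x × Even (x - total r)) (suc (length r))
many-flips {a} {r} 0<a below distinct =
  map flipped (+ 0 ∷ r) ,
  AllPairs.map⁺ (pairs ((≤-refl , 0<a) ∷ All.map (λ (p , q) → <⇒≤ p , q) below)
                       (All.map (λ { (p , _) refl → <-irrefl refl p }) below ∷ distinct)) ,
  (Sums-resp-≡ (sym (+-identityʳ T)) (Full-total r) , + 0 , +-inverseʳ-0 T) ∷
    All.map⁺ (All.tabulate λ {b} b∈ → Full-total-flip b∈ , - b , even T b) ,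
  ℕ.≤-reflexive (cong suc (sym (length-map flipped r)))
  where
  T : ℤ
  T = total r
  flipped : ℤ → ℤ
  flipped b = T - (b + b)
  +-inverseʳ-0 : ∀ T → T + + 0 - T ≡ + 0 + + 0
  +-inverseʳ-0 = solve-∀
  even : ∀ T b → T - (b + b) - T ≡ - b + - b
  even = solve-∀
  flip-flip : ∀ T b c → c - b + (c - b) ≡ T - (b + b) - (T - (c + c))
  flip-flip = solve-∀
  incongruent : ∀ {b c} → + 0 ≤ b × b < a → + 0 ≤ c × c < a → b ≢ c → [ a + a ] flipped b ≢ₘ flipped c
  incongruent {b} {c} (0≤b , b<a) (0≤c , c<a) b≢c (divides q eq) =
    b≢c (sym (small-multiple 0≤c c<a 0≤b b<a (divides q (halve-≡ (begin
      c - b + (c - b)          ≡⟨ flip-flip T b c ⟩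
      T - (b + b) - (T - (c + c)) ≡⟨ eq ⟩
      q * (a + a)              ≡⟨ solve (q ▸ a ▸ ⟨⟩) ⟩
      q * a + q * a            ∎)))))
    where open ≡-Reasoning
  pairs : ∀ {L} → All (λ b → + 0 ≤ b × b < a) L → AllPairs _≢_ L →
          AllPairs (λ b c → [ a + a ] flipped b ≢ₘ flipped c) L
  pairs []       []       = []
  pairs (p ∷ ps) (n ∷ ns) = All.zipWith (λ (q , b≢c) → incongruent p q b≢c) (ps , n) ∷ pairs ps ns

-- The `k + 1` sums without `a` have the parity of `o + total s`, the `k` sums without `o` that of
-- `a + total s`. As `2a` is even, the two families share no class.
many-mixed-parity : ∀ {a o s} → + 0 < a → All (Below a) (o ∷ s) → AllPairs _≢_ (o ∷ s) → Odd (a - o) →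
                    let k = length (o ∷ s) in
                    Many [ a + a ]_≢ₘ_ (Sums k (a ∷ o ∷ s)) (suc (k ℕ.+ k))
many-mixed-parity {a} {o} {s} 0<a below distinct (c , a-o) =
  Many-∪ {P = λ x → Full (o ∷ s) x × Even (x - total (o ∷ s))} {Q = Q} cross
    (λ (f , _) → skip f) proj₁
    (many-flips 0<a below distinct)
    (Many-map (_+_ a)
      (λ {x} {y} n d → n (subst ((a + a) ∣_) (cancel a x y) d))
      (λ {x} (f , d , e) → plus (skip f) , d , ≡.trans (cancel a x (total s)) e)
      (many-flips 0<a (All.tail below) (AllPairs.tail distinct)))
  where
  Q : ℤ → Set
  Q x = Sums (length (o ∷ s)) (a ∷ o ∷ s) x × Even (x - (a + total s))
  cancel : ∀ a x y → a + x - (a + y) ≡ x - y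
  cancel = solve-∀
  cross : ∀ {x y} → Full (o ∷ s) x × Even (x - total (o ∷ s)) → Q y → [ a + a ] x ≢ₘ y
  cross {x} {y} (_ , d , x-T) (_ , e , y-T) (divides q x-y) =
    ¬Even×Odd {a - o} (d - e - q * a , (begin
      a - o                                              ≡⟨ split x y t ⟩
      x - (o + t) - (y - (a + t)) - (x - y)              ≡⟨ cong₂ _-_ (cong₂ _-_ x-T y-T) x-y ⟩
      d + d - (e + e) - q * (a + a)                      ≡⟨ solve (d ▸ e ▸ q ▸ a ▸ ⟨⟩) ⟩
      d - e - q * a + (d - e - q * a)                    ∎)) (c , a-o)
    where
    open ≡-Reasoning
    t : ℤ
    t = total s
    split : ∀ x y t → a - o ≡ x - (o + t) - (y - (a + t)) - (x - y)
    split x y t = solve (a ▸ o ▸ x ▸ y ▸ t ▸ ⟨⟩)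

module OddModulus (a : ℤ) (odd-a : Odd a) where

  -- With `a = 1 + 2c` and `2x = qa`, one has `x = xa - c(2x) = (x - cq)a`.
  half : ∀ {x} → a ∣ (x + x) → a ∣ x
  half {x} (divides q eq) = divides (x - proj₁ odd-a * q) (begin
    x                                                        ≡⟨ expand x (proj₁ odd-a) ⟩
    x * (+ 1 + (proj₁ odd-a + proj₁ odd-a)) - proj₁ odd-a * (x + x)
      ≡⟨ cong₂ (λ u v → x * u - proj₁ odd-a * v) (sym (proj₂ odd-a)) eq ⟩
    x * a - proj₁ odd-a * (q * a)                            ≡⟨ factor x (proj₁ odd-a) q a ⟩
    (x - proj₁ odd-a * q) * a                                ∎)
    where
    open ≡-Reasoning
    expand : ∀ x c → x ≡ x * (+ 1 + (c + c)) - c * (x + x)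
    expand = solve-∀
    factor : ∀ x c q a → x * a - c * (q * a) ≡ (x - c * q) * a
    factor = solve-∀

  ∣-+ : ∀ {x y} → a ∣ x → a ∣ y → a ∣ (x + y)
  ∣-+ = ∣m∣n⇒∣m+n

  ∣-neg : ∀ {x} → a ∣ x → a ∣ (- x)
  ∣-neg = ∣m⇒∣-m

  open Residues (a ∣_) (a ∣?_) (divides (+ 0) refl) ∣-+ ∣-neg half public

  mod-3 : ∀ q → ∃ λ s → q ≡ + 3 * s ⊎ q ≡ + 1 + + 3 * s ⊎ q ≡ + 2 + + 3 * s
  mod-3 q with q %ℕ 3 | n%ℕd<d q 3 | a≡a%ℕn+[a/ℕn]*n q 3
  ... | 0 | _ | eq = q /ℕ 3 , inj₁ (≡.trans eq (lemma (q /ℕ 3)))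
    where
    lemma : ∀ s → + 0 + s * + 3 ≡ + 3 * s
    lemma = solve-∀
  ... | 1 | _ | eq = q /ℕ 3 , inj₂ (inj₁ (≡.trans eq (cong (_+_ (+ 1)) (*-comm (q /ℕ 3) (+ 3)))))
  ... | 2 | _ | eq = q /ℕ 3 , inj₂ (inj₂ (≡.trans eq (cong (_+_ (+ 2)) (*-comm (q /ℕ 3) (+ 3)))))
  ... | suc (suc (suc _)) | s≤s (s≤s (s≤s ())) | _

  third : ∀ {x q} → + 3 * x ≡ + 3 * q * a → a ∣ x
  third {x} {q} eq = divides q (*-cancelˡ-≡ (+ 3) x (q * a) (≡.trans eq (*-assoc (+ 3) q a)))

  -- ±a/3 are the only nonzero residues killed by 3.
  no-two-thirds : ∀ {b c} → ¬ (a ∣ b) → ¬ (a ∣ c) → b # c → ¬ ((a ∣ (b + b + b)) × (a ∣ (c + c + c)))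
  no-two-thirds {b} {c} b≉0 c≉0 (b≉c , b≉-c) (divides q eq , divides q′ eq′) = cases (mod-3 q) (mod-3 q′)
    where
    open ≡-Reasoning
    thrice : ∀ x {y} → x + x + x ≡ y → + 3 * x ≡ y
    thrice x e = ≡.trans (lemma x) e
      where
      lemma : ∀ x → + 3 * x ≡ x + x + x
      lemma = solve-∀
    zero-class : ∀ {x s} → ¬ (a ∣ x) → x + x + x ≡ + 3 * s * a → ⊥
    zero-class {x} {s} n e = n (third {x} {s} (thrice x e))
    same : ∀ s s′ r → q ≡ r + + 3 * s → q′ ≡ r + + 3 * s′ → ⊥
    same s s′ r refl refl = b≉c (third {b - c} {s - s′} (begin
      + 3 * (b - c)                                 ≡⟨ solve (b ▸ c ▸ ⟨⟩) ⟩
      b + b + b - (c + c + c)                       ≡⟨ cong₂ _-_ eq eq′ ⟩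
      (r + + 3 * s) * a - (r + + 3 * s′) * a        ≡⟨ solve (r ▸ s ▸ s′ ▸ a ▸ ⟨⟩) ⟩
      + 3 * (s - s′) * a                            ∎))
    opposite : ∀ s s′ r r′ → r + r′ ≡ + 3 → q ≡ r + + 3 * s → q′ ≡ r′ + + 3 * s′ → ⊥
    opposite s s′ r r′ r+r′ refl refl = b≉-c (third {b + c} {+ 1 + s + s′} (begin
      + 3 * (b + c)                                 ≡⟨ solve (b ▸ c ▸ ⟨⟩) ⟩
      b + b + b + (c + c + c)                       ≡⟨ cong₂ _+_ eq eq′ ⟩
      (r + + 3 * s) * a + (r′ + + 3 * s′) * a       ≡⟨ solve (r ▸ r′ ▸ s ▸ s′ ▸ a ▸ ⟨⟩) ⟩
      (r + r′ + + 3 * (s + s′)) * a                 ≡⟨ cong (λ t → (t + + 3 * (s + s′)) * a) r+r′ ⟩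
      (+ 3 + + 3 * (s + s′)) * a                    ≡⟨ solve (s ▸ s′ ▸ a ▸ ⟨⟩) ⟩
      + 3 * (+ 1 + s + s′) * a                      ∎))
    -- Modulo 3, a zero quotient makes `b` or `c` vanish, equal quotients give `b ≡ c`, and opposite
    -- ones give `b ≡ - c`.
    cases : (∃ λ s → q ≡ + 3 * s ⊎ q ≡ + 1 + + 3 * s ⊎ q ≡ + 2 + + 3 * s) →
            (∃ λ s → q′ ≡ + 3 * s ⊎ q′ ≡ + 1 + + 3 * s ⊎ q′ ≡ + 2 + + 3 * s) → ⊥
    cases (s , inj₁ refl)        _                      = zero-class {b} {s} b≉0 eq
    cases _                      (s , inj₁ refl)        = zero-class {c} {s} c≉0 eq′
    cases (s , inj₂ (inj₁ e))    (s′ , inj₂ (inj₁ e′))  = same s s′ (+ 1) e e′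
    cases (s , inj₂ (inj₂ e))    (s′ , inj₂ (inj₂ e′))  = same s s′ (+ 2) e e′
    cases (s , inj₂ (inj₁ e))    (s′ , inj₂ (inj₂ e′))  = opposite s s′ (+ 1) (+ 2) refl e e′
    cases (s , inj₂ (inj₂ e))    (s′ , inj₂ (inj₁ e′))  = opposite s s′ (+ 2) (+ 1) refl e e′

  below⇒≉0 : ∀ {b} → Below a b → ¬ (a ∣ b)
  below⇒≉0 {b} (0<b , b<a) d = <-irrefl
    (sym (small-multiple (<⇒≤ 0<b) b<a ≤-refl (<-trans 0<b b<a) (subst (a ∣_) (sym (+-identityʳ b)) d))) 0<b

  -- Oddness makes `b + c = 2m` with `0 < m < a`, so the odd `a` cannot divide it.
  below⇒# : ∀ {b c} → Below a b → Below a c → Odd b → Odd c → b ≢ c → b # c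
  below⇒# {b} {c} (0<b , b<a) (0<c , c<a) (b′ , b≡) (c′ , c≡) b≢c =
    (λ d → b≢c (small-multiple (<⇒≤ 0<b) b<a (<⇒≤ 0<c) c<a d)) ,
    (λ d → below⇒≉0 {m} (double-cancel-< (subst (+ 0 <_) b+c (+-mono-< 0<b 0<c)) ,
                     double-cancel-< (subst (_< a + a) b+c (+-mono-< b<a c<a)))
                    (half (subst (a ∣_) b+c d)))
    where
    m : ℤ
    m = + 1 + b′ + c′
    b+c : b + c ≡ m + m
    b+c = ≡.trans (cong₂ _+_ b≡ c≡) (eq b′ c′)
      where
      eq : ∀ b c → + 1 + (b + b) + (+ 1 + (c + c)) ≡ + 1 + b + c + (+ 1 + b + c)
      eq = solve-∀

  below⇒⋕ : ∀ {r} → All (Below a) r → All Odd r → AllPairs _≢_ r → AllPairs _⋕_ r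
  below⇒⋕ [] [] [] = []
  below⇒⋕ {b ∷ _} (p ∷ ps) (o ∷ os) (n ∷ ns) = row p o ps os n ∷ below⇒⋕ ps os ns
    where
    row : ∀ {b r} → Below a b → Odd b → All (Below a) r → All Odd r → All (b ≢_) r → All (b ⋕_) r
    row p o []       []       []       = []
    row {b} {c ∷ _} p o (q ∷ qs) (o′ ∷ os) (n ∷ ns) =
      (b#c , no-two-thirds {b} {c} (below⇒≉0 p) (below⇒≉0 q) b#c) ∷ row p o qs os ns
      where
      b#c : b # c
      b#c = below⇒# p q o o′ n

many-odd : ∀ {a r} → Odd a → All (Below a) r → All Odd r → AllPairs _≢_ r → 3 ℕ.≤ length r →
           Many [ a + a ]_≢ₘ_ (Sums (length r) (a ∷ r)) (suc (length r ℕ.+ length r))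
many-odd {a} {r} odd-a below odds distinct 3≤ with k , len ← ℕ.m≤n⇒∃[o]m+o≡n 3≤ =
  Many-map {R = _≉_} (λ x → x) (λ n (divides q e) → n (divides (q + q) (≡.trans e (eq q a))))
    skip (Full-many k r (sym len) (All.map below⇒≉0 below) (below⇒⋕ below odds distinct))
  where
  open OddModulus a odd-a
  eq : ∀ q a → q * (a + a) ≡ (q + q) * a
  eq = solve-∀

double : ℤ → ℤ
double x = x + x

halves : ∀ {r} → All Even r → ∃ λ r′ → r ≡ map double r′
halves []               = [] , refl
halves ((c , refl) ∷ p) with r′ , refl ← halves p = c ∷ r′ , refl

-- The bound `n` on `a` makes repeated halving structurally recursive: it drops by one at each
-- halving.
many-residues : ∀ n {a r} → a ≤ + n → + 0 < a → All (Below a) r → AllPairs _≢_ r → 3 ℕ.≤ length r →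
                Many [ a + a ]_≢ₘ_ (Sums (length r) (a ∷ r)) (suc (length r ℕ.+ length r))

many-residues-even : ∀ n {c r} → c + c ≤ + n → + 0 < c + c → All (Below (c + c)) r → All Even r →
                     AllPairs _≢_ r → 3 ℕ.≤ length r →
                     Many [ c + c + (c + c) ]_≢ₘ_ (Sums (length r) (c + c ∷ r)) (suc (length r ℕ.+ length r))

many-residues n {a} {r} a≤n 0<a below distinct 3≤ with All.decide (λ b → parity (a - b)) r
... | inj₂ mixed with o , o∈ , odd ← find mixed with s , p ← extract o∈ =
  subst (λ k → Many [ a + a ]_≢ₘ_ (Sums k (a ∷ r)) (suc (k ℕ.+ k))) (sym (↭-length p))
    (Many-⊆ (Sums-resp-↭ (prep a (↭-sym p)))
      (many-mixed-parity 0<a (All-resp-↭ p below) (AllPairs-resp-↭ (_∘ sym) p distinct) odd))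
... | inj₁ evens with parity a
...   | inj₁ (c , refl) = many-residues-even n {c} a≤n 0<a below (All.map even evens) distinct 3≤
  where
  even : ∀ {b} → Even (c + c - b) → Even b
  even {b} (d , eq) = c - d , (begin
    b                      ≡⟨ solve (b ▸ c ▸ ⟨⟩) ⟩
    c + c - (c + c - b)    ≡⟨ cong (_-_ (c + c)) eq ⟩
    c + c - (d + d)        ≡⟨ solve (c ▸ d ▸ ⟨⟩) ⟩
    c - d + (c - d)        ∎)
    where open ≡-Reasoning
...   | inj₂ (c , refl) = many-odd (c , refl) below (All.map odd evens) distinct 3≤
  where
  odd : ∀ {b} → Even (+ 1 + (c + c) - b) → Odd b
  odd {b} (d , eq) = c - d , (begin
    b                                        ≡⟨ solve (b ▸ c ▸ ⟨⟩) ⟩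
    + 1 + (c + c) - (+ 1 + (c + c) - b)      ≡⟨ cong (_-_ (+ 1 + (c + c))) eq ⟩
    + 1 + (c + c) - (d + d)                  ≡⟨ solve (c ▸ d ▸ ⟨⟩) ⟩
    + 1 + (c - d + (c - d))                  ∎)
    where open ≡-Reasoning

many-residues-even zero le 0<a _ _ _ _ = ⊥-elim (<-irrefl refl (<-≤-trans 0<a le))
many-residues-even (suc n) {c} le 0<a below evens distinct 3≤ with r , refl ← halves evens =
  subst (λ k → Many [ c + c + (c + c) ]_≢ₘ_ (Sums k (c + c ∷ map double r)) (suc (k ℕ.+ k))) (sym (length-map double r))
    (Many-map {R = [ c + c ]_≢ₘ_} double (λ {x} {y} → congruent {x} {y}) Sums-double
      (many-residues n (i<j⇒i≤pred[j] (<-≤-trans c<c+c le)) 0<c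
        (All.map (λ (p , q) → double-cancel-< p , double-cancel-< q) (All.map⁻ below))
        (AllPairs.map (λ { x≢y refl → x≢y refl }) (AllPairs.map⁻ distinct))
        (subst (3 ℕ.≤_) (length-map double r) 3≤)))
  where
  0<c : + 0 < c
  0<c = double-cancel-< 0<a
  c<c+c : c < c + c
  c<c+c = subst (_< c + c) (+-identityʳ c) (+-monoʳ-< c 0<c)
  congruent : ∀ {x y} → [ c + c ] x ≢ₘ y → [ c + c + (c + c) ] double x ≢ₘ double y
  congruent {x} {y} n (divides q eq) = n (divides q (halve-≡ (begin
    x - y + (x - y)            ≡⟨ solve (x ▸ y ▸ ⟨⟩) ⟩
    x + x - (y + y)            ≡⟨ eq ⟩
    q * (c + c + (c + c))      ≡⟨ solve (q ▸ c ▸ ⟨⟩) ⟩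
    q * (c + c) + q * (c + c)  ∎)))
    where open ≡-Reasoning

-- Lower bounds

Many-neg : ∀ {P n} → (∀ {x} → P x → P (- x)) → Many _≢_ (λ x → P x × + 0 < x) n → Many _≢_ P (n ℕ.+ n)
Many-neg {P} P-neg many = Many-∪ {R = _≢_} {P = λ x → P x × + 0 < x} {Q = λ x → P x × x < + 0}
  (λ { (_ , 0<x) (_ , x<0) refl → <-asym 0<x x<0 }) proj₁ proj₁ many
  (Many-map -_ (λ x≢y eq → x≢y (neg-injective eq)) (λ (p , 0<x) → P-neg p , neg-mono-< 0<x) many)

chain : ∀ {P : Pred ℤ 0ℓ} L → Linked _>_ (L ++ + 0 ∷ []) → All P L →
        Many _≢_ (λ x → P x × + 0 < x) (length L)
chain {P} L links ps = L , AllPairs.map (λ x>y x≡y → <-irrefl (sym x≡y) x>y) (proj₁ (unsnoc L pairs)) ,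
                   All.zip (ps , proj₂ (unsnoc L pairs)) , ℕ.≤-refl
  where
  pairs : AllPairs _>_ (L ++ + 0 ∷ [])
  pairs = Linked⇒AllPairs (λ p q → <-trans q p) links
  unsnoc : ∀ L → AllPairs _>_ (L ++ + 0 ∷ []) → AllPairs _>_ L × All (+ 0 <_) L
  unsnoc []      _        = [] , []
  unsnoc (x ∷ L) (r ∷ rs) with p , q ← unsnoc L rs = All.++⁻ˡ L r ∷ p , All.head (All.++⁻ʳ L r) ∷ q

gt : ∀ u v {d} → + 0 < d → u - v ≡ d → u > v
gt u v 0<d eq = 0<-⇒< (subst (+ 0 <_) (sym eq) 0<d)

-- If `y - x` and `x - w` differ, they join `y + x > y + w > y - w` to give five positive sums. If
-- `x + w` and `y - w` differ, they lie between `y + w` and `x - w`. Both equalities together force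
-- the ratio 1 : 3 : 5.
sums-of-two-of-three : ∀ {w x y} → + 0 < w → w < x → x < y →
                       Many _≢_ (Sums 2 (y ∷ x ∷ w ∷ [])) 10 ⊎ (x ≡ + 3 * w × y ≡ + 5 * w)
sums-of-two-of-three {w} {x} {y} 0<w w<x x<y = cases (<-cmp (y - x) (x - w)) (<-cmp (x + w) (y - w))
  where
  S : ℤ → Set
  S = Sums 2 (y ∷ x ∷ w ∷ [])
  0<x-w : + 0 < x - w
  0<x-w = <⇒0<- w<x
  0<y-x : + 0 < y - x
  0<y-x = <⇒0<- x<y
  y+x : S (y + x)
  y+x = Sums-resp-≡ (cong (_+_ y) (+-identityʳ x)) (plus (plus (skip nil)))
  y+w : S (y + w)
  y+w = Sums-resp-≡ (cong (_+_ y) (+-identityʳ w)) (plus (skip (plus nil)))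
  y-w : S (y - w)
  y-w = Sums-resp-≡ (cong (_+_ y) (+-identityʳ (- w))) (plus (skip (minus nil)))
  y-x : S (y - x)
  y-x = Sums-resp-≡ (cong (_+_ y) (+-identityʳ (- x))) (plus (minus (skip nil)))
  x+w : S (x + w)
  x+w = Sums-resp-≡ (cong (_+_ x) (+-identityʳ w)) (skip (plus (plus nil)))
  x-w : S (x - w)
  x-w = Sums-resp-≡ (cong (_+_ x) (+-identityʳ (- w))) (skip (plus (minus nil)))
  y+x>y+w : y + x > y + w
  y+x>y+w = +-monoʳ-< y w<x
  y+w>x+w : y + w > x + w
  y+w>x+w = +-monoˡ-< w x<y
  y+w>y-w : y + w > y - w
  y+w>y-w = +-monoʳ-< y (<-trans (neg-mono-< 0<w) 0<w)
  x+w>x-w : x + w > x - w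
  x+w>x-w = +-monoʳ-< x (<-trans (neg-mono-< 0<w) 0<w)
  y-w>y-x : y - w > y - x
  y-w>y-x = +-monoʳ-< y (neg-mono-< w<x)
  y-w>x-w : y - w > x - w
  y-w>x-w = +-monoˡ-< (- w) x<y
  ten : ∀ {a b c d e} → Linked _>_ (a ∷ b ∷ c ∷ d ∷ e ∷ + 0 ∷ []) → All S (a ∷ b ∷ c ∷ d ∷ e ∷ []) → Many _≢_ S 10
  ten links s = Many-neg Sums-neg (chain _ links s)
  cases : Tri (y - x < x - w) (y - x ≡ x - w) (y - x > x - w) → Tri (x + w < y - w) (x + w ≡ y - w) (x + w > y - w) →
          Many _≢_ S 10 ⊎ (x ≡ + 3 * w × y ≡ + 5 * w)
  cases (tri< lt _ _) _ = inj₁ (ten (y+x>y+w ∷ y+w>y-w ∷ y-w>x-w ∷ lt ∷ 0<y-x ∷ [-]) (y+x ∷ y+w ∷ y-w ∷ x-w ∷ y-x ∷ []))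
  cases (tri> _ _ gt) _ = inj₁ (ten (y+x>y+w ∷ y+w>y-w ∷ y-w>y-x ∷ gt ∷ 0<x-w ∷ [-]) (y+x ∷ y+w ∷ y-w ∷ y-x ∷ x-w ∷ []))
  cases _ (tri< lt _ _) = inj₁ (ten (y+x>y+w ∷ y+w>y-w ∷ lt ∷ x+w>x-w ∷ 0<x-w ∷ [-]) (y+x ∷ y+w ∷ y-w ∷ x+w ∷ x-w ∷ []))
  cases _ (tri> _ _ gt) = inj₁ (ten (y+x>y+w ∷ y+w>x+w ∷ gt ∷ y-w>x-w ∷ 0<x-w ∷ [-]) (y+x ∷ y+w ∷ x+w ∷ y-w ∷ x-w ∷ []))
  cases (tri≈ _ p _) (tri≈ _ q _) = inj₂ (x≡ , y≡)
    where
    open ≡-Reasoning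
    x≡ : x ≡ + 3 * w
    x≡ = begin
      x                                           ≡⟨ solve (x ▸ y ▸ w ▸ ⟨⟩) ⟩
      y - w - (y - x) + w                         ≡⟨ cong₂ (λ s t → s - t + w) (sym q) p ⟩
      x + w - (x - w) + w                         ≡⟨ solve (x ▸ w ▸ ⟨⟩) ⟩
      + 3 * w                                     ∎
    y≡ : y ≡ + 5 * w
    y≡ = begin
      y                                           ≡⟨ solve (y ▸ w ▸ ⟨⟩) ⟩
      y - w + w                                   ≡⟨ cong (_+ w) (sym q) ⟩
      x + w + w                                   ≡⟨ cong (λ t → t + w + w) x≡ ⟩
      + 3 * w + w + w                             ≡⟨ solve (w ▸ ⟨⟩) ⟩
      + 5 * w                                     ∎

-- The triple has only eight sums of two, so `Many-classes` would give just 15; eight positive sums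
-- are listed instead. Their order depends on whether `z - 4w` exceeds `3w`; when these coincide, at
-- `z = 7w`, the sum `7w` replaces `3w`.
sums-1-3-5-z : ∀ {w z} → + 0 < w → + 5 * w < z →
               Many _≢_ (Sums 3 (z ∷ + 5 * w ∷ + 3 * w ∷ w ∷ [])) 16
sums-1-3-5-z {w} {z} 0<w 5w<z = Many-neg Sums-neg (cases (<-cmp z (+ 7 * w)))
  where
  S : ℤ → Set
  S = Sums 3 (z ∷ + 5 * w ∷ + 3 * w ∷ w ∷ [])
  0<2w : + 0 < w + w
  0<2w = +-mono-< 0<w 0<w
  0<z-5w : + 0 < z - + 5 * w
  0<z-5w = <⇒0<- 5w<z
  z+8w : S (z + + 8 * w)
  z+8w = Sums-resp-≡ (eq z w) (plus (plus (plus (skip nil))))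
    where
    eq : ∀ z w → z + (+ 5 * w + (+ 3 * w + + 0)) ≡ z + + 8 * w
    eq = solve-∀
  z+6w : S (z + + 6 * w)
  z+6w = Sums-resp-≡ (eq z w) (plus (plus (skip (plus nil))))
    where
    eq : ∀ z w → z + (+ 5 * w + (w + + 0)) ≡ z + + 6 * w
    eq = solve-∀
  z+4w : S (z + + 4 * w)
  z+4w = Sums-resp-≡ (eq z w) (plus (skip (plus (plus nil))))
    where
    eq : ∀ z w → z + (+ 3 * w + (w + + 0)) ≡ z + + 4 * w
    eq = solve-∀
  z+2w : S (z + + 2 * w)
  z+2w = Sums-resp-≡ (eq z w) (plus (skip (plus (minus nil))))
    where
    eq : ∀ z w → z + (+ 3 * w + (- w + + 0)) ≡ z + + 2 * w
    eq = solve-∀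
  z-2w : S (z - + 2 * w)
  z-2w = Sums-resp-≡ (eq z w) (plus (skip (minus (plus nil))))
    where
    eq : ∀ z w → z + (- (+ 3 * w) + (w + + 0)) ≡ z - + 2 * w
    eq = solve-∀
  z-4w : S (z - + 4 * w)
  z-4w = Sums-resp-≡ (eq z w) (plus (skip (minus (minus nil))))
    where
    eq : ∀ z w → z + (- (+ 3 * w) + (- w + + 0)) ≡ z - + 4 * w
    eq = solve-∀
  7w : S (+ 7 * w)
  7w = Sums-resp-≡ (eq w) (skip (plus (plus (minus nil))))
    where
    eq : ∀ w → + 5 * w + (+ 3 * w + (- w + + 0)) ≡ + 7 * w
    eq = solve-∀
  3w : S (+ 3 * w)
  3w = Sums-resp-≡ (eq w) (skip (plus (minus (plus nil))))
    where
    eq : ∀ w → + 5 * w + (- (+ 3 * w) + (w + + 0)) ≡ + 3 * w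
    eq = solve-∀
  1w : S w
  1w = Sums-resp-≡ (eq w) (skip (plus (minus (minus nil))))
    where
    eq : ∀ w → + 5 * w + (- (+ 3 * w) + (- w + + 0)) ≡ w
    eq = solve-∀
  8>6 : z + + 8 * w > z + + 6 * w
  8>6 = gt (z + + 8 * w) (z + + 6 * w) 0<2w (solve (z ▸ w ▸ ⟨⟩))
  6>4 : z + + 6 * w > z + + 4 * w
  6>4 = gt (z + + 6 * w) (z + + 4 * w) 0<2w (solve (z ▸ w ▸ ⟨⟩))
  4>2 : z + + 4 * w > z + + 2 * w
  4>2 = gt (z + + 4 * w) (z + + 2 * w) 0<2w (solve (z ▸ w ▸ ⟨⟩))
  2>-2 : z + + 2 * w > z - + 2 * w
  2>-2 = gt (z + + 2 * w) (z - + 2 * w) (+-mono-< 0<2w 0<2w) (solve (z ▸ w ▸ ⟨⟩))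
  -2>-4 : z - + 2 * w > z - + 4 * w
  -2>-4 = gt (z - + 2 * w) (z - + 4 * w) 0<2w (solve (z ▸ w ▸ ⟨⟩))
  -4>1w : z - + 4 * w > w
  -4>1w = gt (z - + 4 * w) w 0<z-5w (solve (z ▸ w ▸ ⟨⟩))
  3w>1w : + 3 * w > w
  3w>1w = gt (+ 3 * w) w 0<2w (solve (w ▸ ⟨⟩))
  cases : Tri (z < + 7 * w) (z ≡ + 7 * w) (z > + 7 * w) → Many _≢_ (λ x → S x × + 0 < x) 8
  cases (tri< z<7w _ _) = chain _
    (8>6 ∷ 6>4 ∷ 4>2 ∷ 2>-2 ∷ gt (z - + 2 * w) (+ 3 * w) 0<z-5w (solve (z ▸ w ▸ ⟨⟩)) ∷
      gt (+ 3 * w) (z - + 4 * w) (<⇒0<- z<7w) (solve (z ▸ w ▸ ⟨⟩)) ∷ -4>1w ∷ 0<w ∷ [-])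
    (z+8w ∷ z+6w ∷ z+4w ∷ z+2w ∷ z-2w ∷ 3w ∷ z-4w ∷ 1w ∷ [])
  cases (tri> _ _ z>7w) = chain _
    (8>6 ∷ 6>4 ∷ 4>2 ∷ 2>-2 ∷ -2>-4 ∷ gt (z - + 4 * w) (+ 3 * w) (<⇒0<- z>7w) (solve (z ▸ w ▸ ⟨⟩)) ∷ 3w>1w ∷ 0<w ∷ [-])
    (z+8w ∷ z+6w ∷ z+4w ∷ z+2w ∷ z-2w ∷ z-4w ∷ 3w ∷ 1w ∷ [])
  cases (tri≈ _ z≡7w _) = chain _
    (8>6 ∷ 6>4 ∷ 4>2 ∷ gt (z + + 2 * w) (+ 7 * w) 0<z-5w (solve (z ▸ w ▸ ⟨⟩)) ∷
      gt (+ 7 * w) (z - + 2 * w) 0<2w (≡.trans (cong (λ t → + 7 * w - (t - + 2 * w)) z≡7w) (eq w)) ∷ -2>-4 ∷ -4>1w ∷ 0<w ∷ [-])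
    (z+8w ∷ z+6w ∷ z+4w ∷ z+2w ∷ 7w ∷ z-2w ∷ z-4w ∷ 1w ∷ [])
    where
    eq : ∀ w → + 7 * w - (+ 7 * w - + 2 * w) ≡ w + w
    eq = solve-∀

Decreasing : List ℤ → Set
Decreasing as = AllPairs _>_ as × All (+ 0 <_) as

tail-decreasing : ∀ {a as} → Decreasing (a ∷ as) → Decreasing as
tail-decreasing (_ ∷ p , _ ∷ q) = p , q

many-residues-decreasing : ∀ {a as} → Decreasing (a ∷ as) → 3 ℕ.≤ length as →
  Many [ a + a ]_≢ₘ_ (Sums (length as) (a ∷ as)) (suc (length as ℕ.+ length as))
many-residues-decreasing {a} {as} (a> ∷ as> , 0<a ∷ 0<as) 3≤ =
  many-residues ∣ a ∣ (≤-reflexive (sym (0≤i⇒+∣i∣≡i (<⇒≤ 0<a)))) 0<a (All.zip (0<as , a>))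
    (AllPairs.map (λ x>y x≡y → <-irrefl (sym x≡y) x>y) as>) 3≤

sums-omitting-one : ∀ k as → length as ≡ 4 ℕ.+ k → Decreasing as →
                    Many _≢_ (Sums (3 ℕ.+ k) as) ((4 ℕ.+ k) ℕ.* (4 ℕ.+ k))
sums-omitting-one zero (z ∷ y ∷ x ∷ w ∷ []) refl
  dec@((z>y ∷ _) ∷ (y>x ∷ _) ∷ (x>w ∷ _) ∷ _ , 0<z ∷ _ ∷ _ ∷ 0<w ∷ []) with sums-of-two-of-three 0<w x>w y>x
-- Ten sums and seven classes make 17, one more than required.
... | inj₁ ten           = Many-mono (ℕ.m≤m+n 16 1) (Many-classes 0<z ten (many-residues-decreasing dec ℕ.≤-refl))
... | inj₂ (refl , refl) = sums-1-3-5-z 0<w z>y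
sums-omitting-one (suc k) (a ∷ as) len dec@(_ , 0<a ∷ _) =
  subst (Many _≢_ _) (square (4 ℕ.+ k)) (Many-classes 0<a
    (sums-omitting-one k as len′ (tail-decreasing dec))
    (subst (λ n → Many [ a + a ]_≢ₘ_ (Sums n (a ∷ as)) (suc (n ℕ.+ n))) len′
      (many-residues-decreasing dec (subst (3 ℕ.≤_) (sym len′) (ℕ.m≤m+n 3 (suc k))))))
  where
  len′ : length as ≡ 4 ℕ.+ k
  len′ = ℕ.suc-injective len
  square : ∀ n → n ℕ.* n ℕ.+ suc (n ℕ.+ n) ≡ suc n ℕ.* suc n
  square = ℕ-Solver.solve-∀

top : ℕ → List ℤ → ℤ
top zero    _        = + 0
top (suc h) []       = + 0
top (suc h) (a ∷ as) = a + top h as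

Sums-top : ∀ h as → h ℕ.≤ length as → Sums h as (top h as)
Sums-top zero    []       _        = nil
Sums-top zero    (a ∷ as) _        = skip (Sums-top zero as z≤n)
Sums-top (suc h) (a ∷ as) (s≤s le) = plus (Sums-top h as le)

0≤top : ∀ h {as} → All (+ 0 <_) as → + 0 ≤ top h as
0≤top zero    _        = ≤-refl
0≤top (suc h) []       = ≤-refl
0≤top (suc h) (p ∷ ps) = +-mono-≤ (<⇒≤ p) (0≤top h ps)

top-∷ : ∀ h {a as} → Decreasing (a ∷ as) → top h as ≤ top h (a ∷ as)
top-∷ zero    _ = ≤-refl
top-∷ (suc h) {as = []} dec = 0≤top (suc h) (proj₂ dec)
top-∷ (suc h) {as = b ∷ bs} dec@((b<a ∷ _) ∷ _ , _) = +-mono-≤ (<⇒≤ b<a) (top-∷ h (tail-decreasing dec))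

Sums≤top : ∀ {h as x} → Decreasing as → Sums h as x → x ≤ top h as
Sums≤top dec nil      = ≤-refl
Sums≤top {h} dec (skip s) = ≤-trans (Sums≤top (tail-decreasing dec) s) (top-∷ h dec)
Sums≤top dec (plus {a = a} s) = +-monoʳ-≤ a (Sums≤top (tail-decreasing dec) s)
Sums≤top dec@(_ , 0<a ∷ _) (minus s) =
  +-mono-≤ (<⇒≤ (<-trans (neg-mono-< 0<a) 0<a)) (Sums≤top (tail-decreasing dec) s)

-- The sums obtained from the h + 1 largest elements by leaving one of them out.
many-near-top : ∀ h as → Decreasing as → suc h ℕ.≤ length as →
  Many _<_ (λ x → Sums h as x × (∀ a → All (_< a) as → top (suc h) as < a + x)) (suc h)
many-near-top zero (b ∷ bs) dec _ =
  + 0 ∷ [] , [] ∷ [] , (skip (Sums-top zero bs z≤n) , λ { a (b<a ∷ _) → +-monoˡ-< (+ 0) b<a }) ∷ [] , ℕ.≤-refl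
many-near-top (suc h) (b ∷ bs) dec@(bs<b ∷ _ , _) (s≤s le)
  with L , r , p , L≥ ← many-near-top h bs (tail-decreasing dec) le =
  top (suc h) bs ∷ map (_+_ b) L ,
  All.map⁺ (All.map (λ (_ , f) → f b bs<b) p) ∷ AllPairs.map⁺ (AllPairs.map (+-monoʳ-< b) r) ,
  (skip (Sums-top (suc h) bs le) , λ { a (b<a ∷ _) → +-monoˡ-< (top (suc h) bs) b<a }) ∷
    All.map⁺ (All.map (λ {x} (s , f) → plus s , λ { a (_ ∷ bs<a) →
      subst (b + top (suc h) bs <_) (+-exchange b a x) (+-monoʳ-< b (f a bs<a)) }) p) ,
  s≤s (ℕ.≤-trans L≥ (ℕ.≤-reflexive (sym (length-map (_+_ b) L))))

-- Old sums lie between `± top (suc h) as`; those from `many-near-top`, increased by `a`, lie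
-- beyond. `Outer` is symmetric so that `Many-neg` supplies the lower end.
many-∷ : ∀ h a as {n} → Decreasing (a ∷ as) → suc h ℕ.≤ length as → Many _≢_ (Sums (suc h) as) n →
         Many _≢_ (Sums (suc h) (a ∷ as)) (n ℕ.+ (suc h ℕ.+ suc h))
many-∷ h a as dec@(as<a ∷ _ , _) le many =
  Many-∪ {R = _≢_} {P = Sums (suc h) as} {Q = Outer}
    (λ { s (_ , inj₁ lt) refl → ≤⇒≯ (Sums≤top (tail-decreasing dec) s) lt
       ; s (_ , inj₂ lt) refl → ≤⇒≯ (Sums≤top (tail-decreasing dec) (Sums-neg s)) lt })
    skip proj₁ many
    (Many-neg (λ {x} (s , o) → Sums-neg s , [ (λ lt → inj₂ (subst (top (suc h) as <_) (sym (neg-involutive x)) lt)) , inj₁ ] o)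
      (Many-map (_+_ a) (λ x<y eq → <-irrefl eq (+-monoʳ-< a x<y))
        (λ (s , f) → (plus s , inj₁ (f a as<a)) , ≤-<-trans (0≤top (suc h) (proj₂ (tail-decreasing dec))) (f a as<a))
        (many-near-top h as (tail-decreasing dec) le)))
  where
  Outer : ℤ → Set
  Outer x = Sums (suc h) (a ∷ as) x × (top (suc h) as < x ⊎ top (suc h) as < - x)

-- `j` counts the elements added above the smallest `4 + h`.
many-sums : ∀ j h as → length as ≡ j ℕ.+ (4 ℕ.+ h) → Decreasing as →
            Many _≢_ (Sums (3 ℕ.+ h) as) ((4 ℕ.+ h) ℕ.* (4 ℕ.+ h) ℕ.+ j ℕ.* (3 ℕ.+ h ℕ.+ (3 ℕ.+ h)))
many-sums zero    h as       len dec = subst (Many _≢_ _) (sym (ℕ.+-identityʳ _)) (sums-omitting-one h as len dec)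
many-sums (suc j) h (a ∷ as) len dec = subst (Many _≢_ _) (regroup ((4 ℕ.+ h) ℕ.* (4 ℕ.+ h)) (3 ℕ.+ h ℕ.+ (3 ℕ.+ h)) j)
  (many-∷ (2 ℕ.+ h) a as dec
    (ℕ.≤-trans (ℕ.≤-trans (ℕ.n≤1+n _) (ℕ.m≤n+m (4 ℕ.+ h) j)) (ℕ.≤-reflexive (sym len′)))
    (many-sums j h as len′ (tail-decreasing dec)))
  where
  len′ : length as ≡ j ℕ.+ (4 ℕ.+ h)
  len′ = ℕ.suc-injective len
  regroup : ∀ s t j → s ℕ.+ j ℕ.* t ℕ.+ t ≡ s ℕ.+ suc j ℕ.* t
  regroup = ℕ-Solver.solve-∀

-- Sums of odd numbers

-- The sum of the `h` largest among the first `k` odd numbers, as a polynomial over the integers.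
largest : ℤ → ℤ → ℤ
largest h k = h * (k + k - h)

odd : ℕ → ℤ
odd i = + suc (i ℕ.+ i)

odds : ℕ → List ℤ
odds = applyDownFrom odd

-- Parity and upper bound at once, as `q` is natural. Skipping the largest odd number adds `h` to
-- `q`, and a minus sign adds that number.
Sums-odds : ∀ {h} k {x} → Sums h (odds k) x → ∃ λ q → x ≡ largest (+ h) (+ k) - (+ q + + q)
Sums-odds zero nil = 0 , refl
Sums-odds {h} (suc k) {x} (skip s) with q , eq ← Sums-odds k s =
  q ℕ.+ h , ≡.trans eq (regroup (+ h) (+ k) (+ q))
  where
  regroup : ∀ h k q → h * (k + k - h) - (q + q) ≡ h * (+ 1 + k + (+ 1 + k) - h) - (q + h + (q + h))
  regroup = solve-∀
Sums-odds {suc h} (suc k) (plus s) with q , eq ← Sums-odds k s =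
  q , ≡.trans (cong (_+_ (odd k)) eq) (regroup (+ h) (+ k) (+ q))
  where
  regroup : ∀ h k q → + 1 + (k + k) + (h * (k + k - h) - (q + q)) ≡
                      (+ 1 + h) * (+ 1 + k + (+ 1 + k) - (+ 1 + h)) - (q + q)
  regroup = solve-∀
Sums-odds {suc h} (suc k) (minus s) with q , eq ← Sums-odds k s =
  q ℕ.+ suc (k ℕ.+ k) , ≡.trans (cong (_+_ (- odd k)) eq) (regroup (+ h) (+ k) (+ q))
  where
  regroup : ∀ h k q → - (+ 1 + (k + k)) + (h * (k + k - h) - (q + q)) ≡
    (+ 1 + h) * (+ 1 + k + (+ 1 + k) - (+ 1 + h)) - (q + (+ 1 + (k + k)) + (q + (+ 1 + (k + k))))
  regroup = solve-∀

gap : ℕ → ℤ → ℤ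
gap q n = n - (+ q + + q)

-- The largest sum of h out of the first h + e odd numbers.
N : ℕ → ℕ → ℕ
N h e = h ℕ.* (h ℕ.+ (e ℕ.+ e))

N-suc : ∀ h e → + N (suc h) e ≡ odd (h ℕ.+ e) + + N h e
N-suc h e = cong +_ (eq h e)
  where
  eq : ∀ h e → (1 ℕ.+ h) ℕ.* (1 ℕ.+ h ℕ.+ (e ℕ.+ e)) ≡ 1 ℕ.+ (h ℕ.+ e ℕ.+ (h ℕ.+ e)) ℕ.+ h ℕ.* (h ℕ.+ (e ℕ.+ e))
  eq = ℕ-Solver.solve-∀

largest≡N : ∀ h e → largest (+ h) (+ (h ℕ.+ e)) ≡ + N h e
largest≡N h e = ≡.trans (cong (_*_ (+ h)) (eq (+ h) (+ e))) (sym (pos-* h (h ℕ.+ (e ℕ.+ e))))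
  where
  eq : ∀ h e → h + e + (h + e) - h ≡ h + (e + e)
  eq = solve-∀

-- `q` numbers the candidate values from the largest down, and `e` is the number of omitted
-- elements.
Attained : ℕ → ℕ → ℕ → Set
Attained h e q = Sums h (odds (h ℕ.+ e)) (gap q (+ N h e))

attained-∷ : ∀ h e q → Attained h e q → Attained (suc h) e q
attained-∷ h e q s = Sums-resp-≡
  (≡.trans (sym (+-assoc (odd (h ℕ.+ e)) (+ N h e) (- (+ q + + q)))) (cong (gap q) (sym (N-suc h e)))) (plus s)

attained-sym : ∀ h e {q q′} → q ℕ.+ q′ ≡ N h e → Attained h e q → Attained h e q′
attained-sym h e {q} {q′} eq s = Sums-resp-≡
  (≡.trans (cong (λ n → - gap q (+ n)) (sym eq)) (≡.trans (negate (+ q) (+ q′)) (cong (λ n → gap q′ (+ n)) eq))) (Sums-neg s)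
  where
  negate : ∀ q q′ → - (q + q′ - (q + q)) ≡ q + q′ - (q′ + q′)
  negate = solve-∀

-- Negation exchanges `q` and `N h e - q`, so nonnegative values suffice. `P` allows an exception,
-- needed for two summands.
attained-half : ∀ h e (P : ℕ → Set) → (∀ {q q′} → q ℕ.+ q′ ≡ N h e → P q → P q′) →
                (∀ q → P q → q ℕ.+ q ℕ.≤ N h e → Attained h e q) →
                ∀ q → P q → q ℕ.≤ N h e → Attained h e q
attained-half h e P P-sym lower q Pq le with q′ , eq ← ℕ.m≤n⇒∃[o]m+o≡n le with ℕ.≤-total q q′
... | inj₁ q≤q′ = lower q Pq (ℕ.≤-trans (ℕ.+-monoʳ-≤ q q≤q′) (ℕ.≤-reflexive eq))
... | inj₂ q′≤q = attained-sym h e {q′} {q} eq′ (lower q′ (P-sym eq Pq) (ℕ.≤-trans (ℕ.+-monoˡ-≤ q′ q′≤q) (ℕ.≤-reflexive eq)))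
  where
  eq′ : q′ ℕ.+ q ≡ N h e
  eq′ = ≡.trans (ℕ.+-comm q′ q) eq

odd-attained : ∀ {i k} → i ℕ.< k → Sums 1 (odds k) (odd i)
odd-attained {i} {suc k} (s≤s i≤k) with ℕ.m≤n⇒m<n∨m≡n i≤k
... | inj₁ i<k  = skip (odd-attained i<k)
... | inj₂ refl = Sums-resp-≡ (+-identityʳ (odd k)) (plus (Sums-top 0 (odds k) z≤n))

halve-≤ : ∀ {m n} → m ℕ.+ m ℕ.≤ suc (n ℕ.+ n) → m ℕ.≤ n
halve-≤ {m} {n} le with m ℕ.≤? n
... | yes m≤n = m≤n
... | no m≰n  = ⊥-elim (ℕ.<⇒≱ (ℕ.≤-trans (ℕ.≤-reflexive (cong suc (sym (ℕ.+-suc n n)))) (ℕ.+-mono-≤ (ℕ.≰⇒> m≰n) (ℕ.≰⇒> m≰n))) le)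

attained-1 : ∀ e q → q ℕ.≤ N 1 e → Attained 1 e q
attained-1 e q = attained-half 1 e (λ _ → ⊤) _ lower q _
  where
  lower : ∀ q → ⊤ → q ℕ.+ q ℕ.≤ N 1 e → Attained 1 e q
  lower q _ le with i , refl ← ℕ.m≤n⇒∃[o]m+o≡n (halve-≤ {q} {e} (ℕ.≤-trans le (ℕ.≤-reflexive (ℕ.*-identityˡ (suc (e ℕ.+ e)))))) =
    Sums-resp-≡ (≡.trans (eq (+ q) (+ i)) (cong (λ n → gap q (+ n)) (sym (ℕ.*-identityˡ (suc (q ℕ.+ i ℕ.+ (q ℕ.+ i)))))))
      (odd-attained (s≤s (ℕ.m≤n+m i q)))
    where
    eq : ∀ q i → + 1 + (i + i) ≡ + 1 + (q + i + (q + i)) - (q + q)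
    eq = solve-∀

-- Zero, at q = 2 + 2e, is not a sum of two distinct odd numbers up to sign.
attained-2 : ∀ e q → q ≢ suc e ℕ.+ suc e → q ℕ.≤ N 2 e → Attained 2 e q
attained-2 e = attained-half 2 e (_≢ suc e ℕ.+ suc e) middle lower
  where
  N≡ : ∀ e → 2 ℕ.* (2 ℕ.+ (e ℕ.+ e)) ≡ (1 ℕ.+ e) ℕ.+ (1 ℕ.+ e) ℕ.+ ((1 ℕ.+ e) ℕ.+ (1 ℕ.+ e))
  N≡ = ℕ-Solver.solve-∀
  middle : ∀ {q q′} → q ℕ.+ q′ ≡ N 2 e → q ≢ suc e ℕ.+ suc e → q′ ≢ suc e ℕ.+ suc e
  middle {q} eq q≢ refl = q≢ (ℕ.+-cancelʳ-≡ (suc e ℕ.+ suc e) q (suc e ℕ.+ suc e) (≡.trans eq (N≡ e)))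
  lower : ∀ q → q ≢ suc e ℕ.+ suc e → q ℕ.+ q ℕ.≤ N 2 e → Attained 2 e q
  lower q q≢ le = attained-∷ 1 e q (attained-1 e q (ℕ.≤-pred (ℕ.≤-trans
    (ℕ.≤∧≢⇒< (halve-≤ (ℕ.≤-trans (ℕ.≤-trans le (ℕ.≤-reflexive (N≡ e))) (ℕ.n≤1+n _))) q≢) (ℕ.≤-reflexive (eq e)))))
    where
    eq : ∀ e → 1 ℕ.+ e ℕ.+ (1 ℕ.+ e) ≡ suc (1 ℕ.* (1 ℕ.+ (e ℕ.+ e)))
    eq = ℕ-Solver.solve-∀

-- For `q` at most half of `N`, the largest odd number can be taken with a plus sign and `q` is
-- still in range for one summand fewer.
attained-≥3 : ∀ i e q → q ℕ.≤ N (3 ℕ.+ i) (suc e) → Attained (3 ℕ.+ i) (suc e) q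
attained-≥3 zero e q = attained-half 3 (suc e) (λ _ → ⊤) _ (λ q _ → lower q) q _
  where
  lower : ∀ q → q ℕ.+ q ℕ.≤ N 3 (suc e) → Attained 3 (suc e) q
  lower q le with q ℕ.≟ suc (suc e) ℕ.+ suc (suc e)
  ... | no q≢    = attained-∷ 2 (suc e) q (attained-2 (suc e) q q≢
    (halve-≤ (ℕ.≤-trans le (ℕ.≤-trans (ℕ.m≤m+n _ (2 ℕ.+ 2 ℕ.* e)) (ℕ.≤-reflexive (eq e))))))
    where
    eq : ∀ e → 3 ℕ.* (3 ℕ.+ ((1 ℕ.+ e) ℕ.+ (1 ℕ.+ e))) ℕ.+ (2 ℕ.+ 2 ℕ.* e) ≡
               1 ℕ.+ (2 ℕ.* (2 ℕ.+ ((1 ℕ.+ e) ℕ.+ (1 ℕ.+ e))) ℕ.+ 2 ℕ.* (2 ℕ.+ ((1 ℕ.+ e) ℕ.+ (1 ℕ.+ e))))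
    eq = ℕ-Solver.solve-∀
  -- The target is the largest odd number `7 + 2e` itself, and the other two summands cannot cancel.
  -- Instead skip it and write `(5 + 2e) + 2`, where 2 is the two-fold sum at `q = 1 + 2e`.
  ... | yes refl = Sums-resp-≡ (eq (+ e)) (skip (plus (attained-2 e (suc (e ℕ.+ e)) q≢
    (ℕ.≤-trans (ℕ.m≤m+n _ (3 ℕ.+ 2 ℕ.* e)) (ℕ.≤-reflexive (eq′ e))))))
    where
    eq : ∀ e → let n = + 2 + (e + e) ; m = + 3 + (+ 1 + e + (+ 1 + e)) in
         + 1 + (+ 2 + e + (+ 2 + e)) + (n + (n + + 0) - (+ 1 + (e + e) + (+ 1 + (e + e)))) ≡
         m + (m + (m + + 0)) - (+ 2 + e + (+ 2 + e) + (+ 2 + e + (+ 2 + e)))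
    eq = solve-∀
    eq′ : ∀ e → 1 ℕ.+ (e ℕ.+ e) ℕ.+ (3 ℕ.+ 2 ℕ.* e) ≡ 2 ℕ.* (2 ℕ.+ (e ℕ.+ e))
    eq′ = ℕ-Solver.solve-∀
    q≢ : suc (e ℕ.+ e) ≢ suc e ℕ.+ suc e
    q≢ p = ℕ.m≢1+m+n (suc (e ℕ.+ e)) {0} (≡.trans p (cong suc (≡.trans (ℕ.+-suc e e) (sym (ℕ.+-identityʳ _)))))
attained-≥3 (suc i) e q = attained-half (4 ℕ.+ i) (suc e) (λ _ → ⊤) _ (λ q _ → lower q) q _
  where
  lower : ∀ q → q ℕ.+ q ℕ.≤ N (4 ℕ.+ i) (suc e) → Attained (4 ℕ.+ i) (suc e) q
  lower q le = attained-∷ (3 ℕ.+ i) (suc e) q (attained-≥3 i e q (halve-≤ (ℕ.≤-trans le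
    (ℕ.≤-trans (ℕ.m≤m+n _ (7 ℕ.+ 6 ℕ.* i ℕ.+ i ℕ.* i ℕ.+ 4 ℕ.* e ℕ.+ 2 ℕ.* (i ℕ.* e))) (ℕ.≤-reflexive (eq i e))))))
    where
    eq : ∀ i e → (4 ℕ.+ i) ℕ.* (4 ℕ.+ i ℕ.+ ((1 ℕ.+ e) ℕ.+ (1 ℕ.+ e))) ℕ.+
                 (7 ℕ.+ 6 ℕ.* i ℕ.+ i ℕ.* i ℕ.+ 4 ℕ.* e ℕ.+ 2 ℕ.* (i ℕ.* e)) ≡
                 1 ℕ.+ ((3 ℕ.+ i) ℕ.* (3 ℕ.+ i ℕ.+ ((1 ℕ.+ e) ℕ.+ (1 ℕ.+ e))) ℕ.+
                        (3 ℕ.+ i) ℕ.* (3 ℕ.+ i ℕ.+ ((1 ℕ.+ e) ℕ.+ (1 ℕ.+ e))))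
    eq = ℕ-Solver.solve-∀

-- From lists back to indexed families and cardinalities

InSignedSumset⇒Sums : ∀ {k h} (a : Fin k → ℤ) {x} → InSignedSumset k h a x → Sums h (tabulate a) x
InSignedSumset⇒Sums {k} a (lam , refl , refl) = go k a lam
  where
  go : ∀ k (a : Fin k → ℤ) (lam : Fin k → Sign) → Sums (sumℕ k (λ i → absSign (lam i))) (tabulate a) (sumℤ k (λ i → signℤ (lam i) * a i))
  go zero    a lam = nil
  go (suc k) a lam with lam Fin.zero | go k (a ∘ Fin.suc) (lam ∘ Fin.suc)
  ... | neg  | s = Sums-resp-≡ (cong₂ _+_ (sym (-1*i≡-i (a Fin.zero))) refl) (minus s)
  ... | zero | s = Sums-resp-≡ (sym (+-identityˡ _)) (skip s)
  ... | pos  | s = Sums-resp-≡ (cong₂ _+_ (sym (*-identityˡ (a Fin.zero))) refl) (plus s)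

Sums⇒InSignedSumset : ∀ {k h} (a : Fin k → ℤ) {x} → Sums h (tabulate a) x → InSignedSumset k h a x
Sums⇒InSignedSumset {zero} a nil = (λ ()) , refl , refl
Sums⇒InSignedSumset {suc k} a (skip s) with lam , refl , refl ← Sums⇒InSignedSumset {k} (a ∘ Fin.suc) s =
  (λ { Fin.zero → zero ; (Fin.suc i) → lam i }) , refl , +-identityˡ _
Sums⇒InSignedSumset {suc k} a (plus s) with lam , refl , refl ← Sums⇒InSignedSumset {k} (a ∘ Fin.suc) s =
  (λ { Fin.zero → pos ; (Fin.suc i) → lam i }) , refl , cong₂ _+_ (*-identityˡ (a Fin.zero)) refl
Sums⇒InSignedSumset {suc k} a (minus s) with lam , refl , refl ← Sums⇒InSignedSumset {k} (a ∘ Fin.suc) s =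
  (λ { Fin.zero → neg ; (Fin.suc i) → lam i }) , refl , cong₂ _+_ (-1*i≡-i (a Fin.zero)) refl

reverse-AllPairs : ∀ {R : Rel ℤ 0ℓ} {as} → AllPairs R as → AllPairs (flip R) (reverse as)
reverse-AllPairs [] = []
reverse-AllPairs {R} {a ∷ as} (r ∷ rs) = subst (AllPairs (flip R)) (sym (unfold-reverse a as))
  (AllPairs.++⁺ (reverse-AllPairs rs) ([] ∷ []) (All.map (_∷ []) (All-resp-↭ (↭-sym (↭-reverse as)) r)))

reverse-decreasing : ∀ {k} {a : Fin k → ℤ} → StrictlyIncreasingPositive k a → Decreasing (reverse (tabulate a))
reverse-decreasing {a = a} (0<a , a<) =
  reverse-AllPairs (AllPairs.tabulate⁺-< (λ {i} {j} → a< i j)) ,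
  All-resp-↭ (↭-sym (↭-reverse (tabulate a))) (All.tabulate⁺ 0<a)

lower-bound-card : ∀ h e (a : Fin (3 ℕ.+ h ℕ.+ suc e) → ℤ) → StrictlyIncreasingPositive _ a →
                   ∀ m → HasCard (InSignedSumset _ (3 ℕ.+ h) a) m → N (3 ℕ.+ h) (suc e) ℕ.+ 1 ℕ.≤ m
lower-bound-card h e a inc m (L , _ , L⇔ , refl) =
  ℕ.≤-trans (ℕ.≤-reflexive (eq h e)) (inside (many-sums e h as len (reverse-decreasing inc)))
  where
  as : List ℤ
  as = reverse (tabulate a)
  inside : ∀ {n} → Many _≢_ (Sums (3 ℕ.+ h) as) n → n ℕ.≤ length L
  inside (U , U≢ , U⊆ , U≥) = ℕ.≤-trans U≥ (pigeonhole {_~_ = _≡_} (λ { x≢y refl refl → x≢y refl }) U≢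
    (All.map (λ s → Equivalence.from (L⇔ _) (Sums⇒InSignedSumset a (Sums-resp-↭ (↭-reverse (tabulate a)) s))) U⊆))
  len : length (reverse (tabulate a)) ≡ e ℕ.+ (4 ℕ.+ h)
  len = ≡.trans (length-reverse (tabulate a)) (≡.trans (length-tabulate a) (comm h e))
    where
    comm : ∀ h e → 3 ℕ.+ h ℕ.+ (1 ℕ.+ e) ≡ e ℕ.+ (4 ℕ.+ h)
    comm = ℕ-Solver.solve-∀
  eq : ∀ h e → (3 ℕ.+ h) ℕ.* (3 ℕ.+ h ℕ.+ ((1 ℕ.+ e) ℕ.+ (1 ℕ.+ e))) ℕ.+ 1 ≡
               (4 ℕ.+ h) ℕ.* (4 ℕ.+ h) ℕ.+ e ℕ.* (3 ℕ.+ h ℕ.+ (3 ℕ.+ h))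
  eq = ℕ-Solver.solve-∀

odd-fin : ∀ {k} → Fin k → ℤ
odd-fin i = odd (toℕ i)

odd-fin-increasing : ∀ k → StrictlyIncreasingPositive k odd-fin
odd-fin-increasing k = (λ i → +<+ (s≤s z≤n)) , (λ i j i<j → +<+ (s≤s (ℕ.+-mono-< i<j i<j)))

tabulate-odd↭odds : ∀ k → tabulate (odd-fin {k}) ↭ odds k
tabulate-odd↭odds k = ↭-trans (↭-sym (↭-reverse (tabulate (odd-fin {k}))))
  (↭-reflexive (≡.trans (cong reverse (tabulate≡applyUpTo odd k)) (reverse-applyUpTo odd k)))
  where
  tabulate≡applyUpTo : ∀ (f : ℕ → ℤ) k → tabulate {n = k} (f ∘ toℕ) ≡ applyUpTo f k
  tabulate≡applyUpTo f zero    = refl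
  tabulate≡applyUpTo f (suc k) = cong (f 0 ∷_) (tabulate≡applyUpTo (f ∘ suc) k)

odds-card : ∀ h e → HasCard (InSignedSumset (3 ℕ.+ h ℕ.+ suc e) (3 ℕ.+ h) odd-fin) (N (3 ℕ.+ h) (suc e) ℕ.+ 1)
odds-card h e = applyUpTo f n , unique , (λ x → mk⇔ to (from ∘ InSignedSumset⇒Sums odd-fin)) , length-applyUpTo f n
  where
  n₀ k n : ℕ
  n₀ = N (3 ℕ.+ h) (suc e)
  k = 3 ℕ.+ h ℕ.+ suc e
  n = n₀ ℕ.+ 1
  n≡ : n ≡ suc n₀
  n≡ = ℕ.+-comm n₀ 1
  f : ℕ → ℤ
  f q = gap q (+ n₀)
  unique : AllPairs _≢_ (applyUpTo f n)
  unique = AllPairs.applyUpTo⁺₁ f n λ {i} {j} i<j _ eq →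
    <-irrefl (neg-injective (+-cancelˡ (+ n₀) eq)) (+<+ (ℕ.+-mono-< i<j i<j))
  to : ∀ {x} → x ∈ applyUpTo f n → InSignedSumset k (3 ℕ.+ h) odd-fin x
  to x∈ with q , q<n , refl ← ∈-applyUpTo⁻ f x∈ = Sums⇒InSignedSumset odd-fin
    (Sums-resp-↭ (↭-sym (tabulate-odd↭odds k)) (attained-≥3 h e q (ℕ.≤-pred (ℕ.≤-trans q<n (ℕ.≤-reflexive n≡)))))
  bound : ∀ {x} → Sums (3 ℕ.+ h) (odds k) x → ∃ λ q → x ≡ f q
  bound s with q , eq ← Sums-odds k s = q , ≡.trans eq (cong (gap q) (largest≡N (3 ℕ.+ h) (suc e)))
  from : ∀ {x} → Sums (3 ℕ.+ h) (tabulate odd-fin) x → x ∈ applyUpTo f n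
  -- Applying `bound` to `x` and to `- x` gives `q + q′ = n₀`, hence `q ≤ n₀`.
  from {x} s with q , p ← bound (Sums-resp-↭ (tabulate-odd↭odds k) s)
                | q′ , p′ ← bound (Sums-resp-↭ (tabulate-odd↭odds k) (Sums-neg s)) =
    subst (_∈ applyUpTo f n) (sym p) (∈-applyUpTo⁺ f (ℕ.≤-trans (s≤s q≤) (ℕ.≤-reflexive (sym n≡))))
    where
    sum : + (q ℕ.+ q′) ≡ + n₀
    sum = halve-≡ (begin
      + q + + q′ + (+ q + + q′)                ≡⟨ expand (+ q) (+ q′) (+ n₀) ⟩
      + n₀ + + n₀ - (gap q (+ n₀) + gap q′ (+ n₀)) ≡⟨ cong₂ (λ s t → + n₀ + + n₀ - (s + t)) (sym p) (sym p′) ⟩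
      + n₀ + + n₀ - (x - x)                    ≡⟨ cancel (+ n₀) x ⟩
      + n₀ + + n₀                              ∎)
      where
      open ≡-Reasoning
      expand : ∀ q q′ n → q + q′ + (q + q′) ≡ n + n - (n - (q + q) + (n - (q′ + q′)))
      expand = solve-∀
      cancel : ∀ n x → n + n - (x - x) ≡ n + n
      cancel = solve-∀
    q≤ : q ℕ.≤ n₀
    q≤ = ℕ.≤-trans (ℕ.m≤m+n q q′) (ℕ.≤-reflexive (+-injective sum))

-- The minuend is `N h e + h * h`, so the truncated subtraction is exact.
2hk∸hh≡N : ∀ h e → 2 ℕ.* h ℕ.* (h ℕ.+ e) ℕ.∸ h ℕ.* h ≡ N h e
2hk∸hh≡N h e = ≡.trans (cong (ℕ._∸ h ℕ.* h) (eq h e)) (ℕ.m+n∸n≡m (N h e) (h ℕ.* h))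
  where
  eq : ∀ h e → 2 ℕ.* h ℕ.* (h ℕ.+ e) ≡ h ℕ.* (h ℕ.+ (e ℕ.+ e)) ℕ.+ h ℕ.* h
  eq = ℕ-Solver.solve-∀

shape-of-h-k : ∀ {h k} → 3 ℕ.≤ h → h ℕ.≤ k ℕ.∸ 1 → ∃ λ h′ → ∃ λ e → h ≡ 3 ℕ.+ h′ × k ≡ 3 ℕ.+ h′ ℕ.+ suc e
shape-of-h-k {suc (suc (suc h))} {suc k} (s≤s (s≤s (s≤s z≤n))) h≤k with e , refl ← ℕ.m≤n⇒∃[o]m+o≡n h≤k =
  h , e , refl , sym (ℕ.+-suc (3 ℕ.+ h) e)

theorem1 : (h k : ℕ) → 3 ℕ.≤ h → h ℕ.≤ k ℕ.∸ 1 →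
    ((a : Fin k → ℤ) → StrictlyIncreasingPositive k a →
    ∀ m → HasCard (InSignedSumset k h a) m → (2 ℕ.* h ℕ.* k ℕ.∸ h ℕ.* h) ℕ.+ 1 ℕ.≤ m)
    × Σ (Fin k → ℤ) (λ a → StrictlyIncreasingPositive k a ×
    HasCard (InSignedSumset k h a) ((2 ℕ.* h ℕ.* k ℕ.∸ h ℕ.* h) ℕ.+ 1))
theorem1 h k 3≤h h≤k-1 with h′ , e , refl , refl ← shape-of-h-k {h} {k} 3≤h h≤k-1
  rewrite 2hk∸hh≡N (3 ℕ.+ h′) (suc e) =
  lower-bound-card h′ e , odd-fin , odd-fin-increasing _ , odds-card h′ e
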